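{- For every positive integer $n$, there exists a type-$1,2,3,4$ $\mathrm{RPA}(n)$.
   Context: Let $[n]=\{1,\ldots,n\}$. A retransmission permutation array of order $n$ ($\mathrm{RPA}(n)$) of type $1$ is an $n\times n$ array with entries from $[n]$ such that (i) every row is a permutation of $[n]$, and (ii) for each $1\le i\le n$, the $i\times\lceil n/i\rceil$ rectangle ($i$ rows, $\lceil n/i\rceil$ columns) in the upper left corner of the array contains all $n$ symbols. Types $2$, $3$ and $4$ are defined identically except that (ii) is required for the $i\times\lceil n/i\rceil$ rectangles ($i$ rows, $\lceil n/i\rceil$ columns) in, respectively, the upper right, lower left and lower right corners. A type-$1,2,3,4$ $\mathrm{RPA}(n)$ is an array that is simultaneously of types $1$, $2$, $3$ and $4$. -}

module Defs where

open import Data.Nat using (ℕ; zero; suc; _+_; _∸_; _<_; _≤_; NonZero)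
open import Data.Nat.DivMod using (_/_)
open import Data.Fin using (Fin; toℕ; opposite)
open import Data.Product using (Σ; _×_; ∃; ∃-syntax)
open import Function.Definitions using (Bijective)
open import Relation.Binary.PropositionalEquality using (_≡_)

⌈_/_⌉ : (n i : ℕ) → .{{NonZero i}} → ℕ
⌈ n / i ⌉ = (n + i ∸ 1) / i

-- An n × n array with entries from [n] (encoded as Fin n); rows and
-- columns are indexed 0..n-1 (row 0 = top row, column 0 = leftmost column).
Array : ℕ → Set
Array n = Fin n → Fin n → Fin n

RowsArePermutations : ∀ {n} → Array n → Set
RowsArePermutations {n} A = (r : Fin n) → Bijective _≡_ _≡_ (A r)

UpperLeftCovers : ∀ {n} → Array n → Set
UpperLeftCovers {n} A =
  (i : ℕ) → .{{_ : NonZero i}} → i ≤ n →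
  (s : Fin n) → ∃[ r ] ∃[ c ] (toℕ r < i × toℕ c < ⌈ n / i ⌉ × A r c ≡ s)

flipCols : ∀ {n} → Array n → Array n
flipCols A r c = A r (opposite c)

flipRows : ∀ {n} → Array n → Array n
flipRows A r c = A (opposite r) c

-- RPA(n) of type 1 (upper left), 2 (upper right), 3 (lower left), 4 (lower right)
RPA-type1 RPA-type2 RPA-type3 RPA-type4 : ∀ {n} → Array n → Set
RPA-type1 A = RowsArePermutations A × UpperLeftCovers A
RPA-type2 A = RowsArePermutations A × UpperLeftCovers (flipCols A)
RPA-type3 A = RowsArePermutations A × UpperLeftCovers (flipRows A)
RPA-type4 A = RowsArePermutations A × UpperLeftCovers (flipRows (flipCols A))

RPA-type1234 : ∀ {n} → Array n → Set
RPA-type1234 A = RPA-type1 A × RPA-type2 A × RPA-type3 A × RPA-type4 A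

{-# OPTIONS --safe #-}
module Submission where

-- Number rows and columns from 0, seen from one of the two upper corners. After i rows, keep
-- the n symbols in n positions: the symbol in position i·c + r (r < i) has been shown in
-- column c. As c ≤ (n - 1)/i < ⌈n/i⌉, this says that the i × ⌈n/i⌉ corner rectangle is
-- complete. Passing to i + 1 rows, position i·c + r becomes (i + 1)·c + r; the ⌊n/(i + 1)⌋
-- symbols for which this is ≥ n are shown again, one in each column t < ⌊n/(i + 1)⌋ of the new
-- row, and take the free positions (i + 1)·t + i. The order in which they do so is arbitrary.
-- The left and the right corner can be served by the same row provided that no symbol has to
-- move on both sides at once. The order is chosen so that the next moves of a symbol on its
-- two sides never fall in the same row; this is possible because at most ⌊n/k⌋ positions move
-- in row k - 1.
-- After m = ⌊n/2⌋ rows the lower half is obtained from the upper one by a half turn and an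
-- involution ψ of the symbols, chosen so that the two outer columns become permutations. For
-- odd n, the two symbols which are then still in the third column of their side are exchanged by
-- ψ and occupy the ends of the middle row.

open import Defs
open import Data.Nat using (ℕ; _≥_)
open import Data.Product using (∃-syntax)
open import Data.Bool using (Bool; true; false; not; _xor_)
open import Data.Bool.Properties using (not-involutive)
open import Data.Empty using (⊥; ⊥-elim)
open import Data.Fin using (Fin; zero; suc; toℕ; fromℕ<; inject≤; join; opposite; punchIn; punchOut; splitAt; _↑ˡ_; _↑ʳ_)
open import Data.Fin.Patterns using (0F; 1F; 2F; 3F; 4F)
open import Data.Fin.Permutation using (Permutation′; permutation; _⟨$⟩ʳ_; _⟨$⟩ˡ_; inverseˡ; inverseʳ; _∘ₚ_; transpose; insert; reverse)
  renaming (id to idₚ)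
open import Data.Fin.Properties using (all?; any?; toℕ-injective; toℕ<n; toℕ-fromℕ<; toℕ-inject≤; opposite-prop; opposite-involutive; punchOut-injective; punchIn-injective; punchIn-punchOut; injective⇒≤; suc-injective; join-splitAt; splitAt-↑ˡ; splitAt-↑ʳ)
  renaming (_≟_ to _≟ᶠ_)
open import Data.Nat using (zero; suc; pred; _+_; _*_; _∸_; _≤_; _<_; _≤?_; _<?_; _≟_; z≤n; z<s; s≤s; s≤s⁻¹; NonZero; ≢-nonZero⁻¹)
open import Data.Nat.DivMod
open import Data.Nat.Divisibility using (divides)
open import Data.Nat.Properties hiding (suc-injective; _≟_; _≤?_; _<?_)
open import Data.Nat.Tactic.RingSolver using (solve-∀)
open import Data.Product using (_×_; _,_; proj₁; proj₂)
open import Data.Sum using (_⊎_; inj₁; inj₂; [_,_]′)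
open import Data.Sum.Properties using (inj₁-injective; inj₂-injective)
open import Data.Vec using (Vec; []; _∷_; lookup)
open import Function.Base using (_∘_)
open import Function.Definitions using (Injective; Bijective)
open import Relation.Binary.Definitions using (tri<; tri≈; tri>)
open import Relation.Binary.PropositionalEquality
open import Relation.Nullary using (Dec; yes; no; ¬?; _×-dec_; _→-dec_)
open import Relation.Nullary.Decidable using (True; toWitness; dec-true; dec-false)

private
  variable
    n q : ℕ

-- Finite counting, permutations and the extension of partial injections.

AtMost : {A : Set} → ℕ → (A → Set) → Set
AtMost {A} k P = (f : Fin (suc k) → A) → Injective _≡_ _≡_ f → (∀ j → P (f j)) → ⊥

perm-injective : (π : Permutation′ n) → Injective _≡_ _≡_ (π ⟨$⟩ʳ_)
perm-injective π eq = trans (sym (inverseˡ π)) (trans (cong (π ⟨$⟩ˡ_) eq) (inverseˡ π))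

perm⁻¹-injective : (π : Permutation′ n) → Injective _≡_ _≡_ (π ⟨$⟩ˡ_)
perm⁻¹-injective π eq = trans (sym (inverseʳ π)) (trans (cong (π ⟨$⟩ʳ_) eq) (inverseʳ π))

injective⇒surjective : (f : Fin n → Fin n) → Injective _≡_ _≡_ f → ∀ y → ∃[ x ] f x ≡ y
injective⇒surjective {suc n} f inj y with any? (λ x → f x ≟ᶠ y)
... | yes hit = hit
... | no miss = ⊥-elim (1+n≰n (injective⇒≤ {f = λ x → punchOut (y≢ x)} λ {x} {x′} eq →
  inj (punchOut-injective (y≢ x) (y≢ x′) eq)))
  where
  y≢ : ∀ x → y ≢ f x
  y≢ x eq = miss (x , sym eq)

injective⇒permutation : (f : Fin n → Fin n) → Injective _≡_ _≡_ f → Permutation′ n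
injective⇒permutation f inj = permutation f (proj₁ ∘ sur) (proj₂ ∘ sur) (λ x → inj (proj₂ (sur (f x))))
  where sur = injective⇒surjective f inj

transpose-left : (i j : Fin n) → transpose i j ⟨$⟩ʳ i ≡ j
transpose-left i j rewrite dec-true (i ≟ᶠ i) refl = refl

transpose-right : (i j : Fin n) → transpose i j ⟨$⟩ʳ j ≡ i
transpose-right i j with j ≟ᶠ i
... | yes j≡i = j≡i
... | no _ rewrite dec-true (j ≟ᶠ j) refl = refl

transpose-other : {i j k : Fin n} → k ≢ i → k ≢ j → transpose i j ⟨$⟩ʳ k ≡ k
transpose-other {i = i} {j} {k} k≢i k≢j
  rewrite dec-false (k ≟ᶠ i) k≢i | dec-false (k ≟ᶠ j) k≢j = refl

abstract
  -- By induction: extend the tail to `ρ` and precompose with the transposition of `c zero` and the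
  -- preimage `b` of `s zero`. The other `c t` differ from both, so their images stay as they are.
  extendInjection : ∀ k (c s : Fin k → Fin n) → Injective _≡_ _≡_ c → Injective _≡_ _≡_ s →
    ∃[ ρ ] (∀ t → ρ ⟨$⟩ʳ c t ≡ s t)
  extendInjection zero c s _ _ = idₚ , λ ()
  extendInjection {n} (suc k) c s c-inj s-inj
    with extendInjection k (c ∘ suc) (s ∘ suc) (suc-injective ∘ c-inj) (suc-injective ∘ s-inj)
  ... | ρ , ρ-ext = transpose (c zero) b ∘ₚ ρ , ext
    where
    b : Fin n
    b = ρ ⟨$⟩ˡ s zero
    ext : ∀ t → ρ ⟨$⟩ʳ (transpose (c zero) b ⟨$⟩ʳ c t) ≡ s t
    ext zero = trans (cong (ρ ⟨$⟩ʳ_) (transpose-left (c zero) b)) (inverseʳ ρ)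
    ext (suc t) = trans (cong (ρ ⟨$⟩ʳ_) (transpose-other (λ eq → case0 (c-inj eq)) c≢b)) (ρ-ext t)
      where
      case0 : ∀ {t : Fin k} → suc t ≡ zero → ⊥
      case0 ()
      c≢b : c (suc t) ≢ b
      c≢b eq = case0 (s-inj (trans (sym (ρ-ext t)) (trans (cong (ρ ⟨$⟩ʳ_) eq) (inverseʳ ρ))))

  -- A new row is prescribed only in its outer columns on both sides; this fills in the rest
  -- arbitrarily.
  extendTwoSided : (c s : Bool → Fin q → Fin n) →
    (∀ {d d′ t t′} → c d t ≡ c d′ t′ → (d , t) ≡ (d′ , t′)) →
    (∀ {d d′ t t′} → s d t ≡ s d′ t′ → (d , t) ≡ (d′ , t′)) →
    ∃[ ρ ] (∀ d t → ρ ⟨$⟩ʳ c d t ≡ s d t)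
  extendTwoSided {q} {n} c s c-inj s-inj = ρ , both
    where
    side : Fin q ⊎ Fin q → Bool × Fin q
    side (inj₁ t) = false , t
    side (inj₂ t) = true , t
    side-inj : ∀ {x y} → side x ≡ side y → x ≡ y
    side-inj {inj₁ _} {inj₁ _} refl = refl
    side-inj {inj₂ _} {inj₂ _} refl = refl
    on : (Bool → Fin q → Fin n) → Fin (q + q) → Fin n
    on f t = f (proj₁ (side (splitAt q t))) (proj₂ (side (splitAt q t)))
    on-inj : (f : Bool → Fin q → Fin n) → (∀ {d d′ t t′} → f d t ≡ f d′ t′ → (d , t) ≡ (d′ , t′)) →
      Injective _≡_ _≡_ (on f)
    on-inj f f-inj {x} {y} eq = trans (sym (join-splitAt q q x))
      (trans (cong (join q q) (side-inj {splitAt q x} {splitAt q y} (f-inj eq))) (join-splitAt q q y))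
    extension : ∃[ ρ ] (∀ t → ρ ⟨$⟩ʳ on c t ≡ on s t)
    extension = extendInjection (q + q) (on c) (on s) (on-inj c c-inj) (on-inj s s-inj)
    ρ : Permutation′ n
    ρ = proj₁ extension
    ext : ∀ t → ρ ⟨$⟩ʳ on c t ≡ on s t
    ext = proj₂ extension
    both : ∀ d t → ρ ⟨$⟩ʳ c d t ≡ s d t
    both false t with ext (t ↑ˡ q)
    ... | e rewrite splitAt-↑ˡ q t q = e
    both true t with ext (q ↑ʳ t)
    ... | e rewrite splitAt-↑ʳ q q t = e

-- Matchings that avoid equal colours.

-- Colour 0 will mean that no further move occurs, so agreement at 0 is harmless.
Avoids : (g h : Fin q → ℕ) → Permutation′ q → Fin q → Set
Avoids g h π t = h t ≡ g (π ⟨$⟩ʳ t) → h t ≡ 0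

abstract
  -- A clash at t of colour v is repaired by swapping with an index b at which neither
  -- colour is v; such a b exists by counting, and the swap creates no new clash.
  avoid : (g h : Fin q → ℕ) → (∀ v → v ≢ 0 → AtMost q (λ x → [ g , h ]′ x ≡ v)) →
    ∃[ π ] (∀ t → Avoids g h π t)
  avoid {q} g h sparse = proj₁ all , λ t → proj₂ all t (toℕ<n t)
    where
    upTo : ∀ k → k ≤ q → ∃[ π ] (∀ t → toℕ t < k → Avoids g h π t)
    upTo zero _ = idₚ , λ _ ()
    upTo (suc k) k<q with upTo k (<⇒≤ k<q)
    ... | π , good with h (fromℕ< k<q) ≟ g (π ⟨$⟩ʳ fromℕ< k<q) ×-dec ¬? (h (fromℕ< k<q) ≟ 0)
    ... | no fine = π , good′
      where
      good′ : ∀ t → toℕ t < suc k → Avoids g h π t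
      good′ t t≤k with t ≟ᶠ fromℕ< k<q
      ... | no t≢ = good t (≤∧≢⇒< (s≤s⁻¹ t≤k) λ eq → t≢ (toℕ-injective (trans eq (sym (toℕ-fromℕ< k<q)))))
      ... | yes refl = λ eq → case (h (fromℕ< k<q) ≟ 0) eq
        where
        case : Dec (h (fromℕ< k<q) ≡ 0) → h (fromℕ< k<q) ≡ g (π ⟨$⟩ʳ fromℕ< k<q) → h (fromℕ< k<q) ≡ 0
        case (yes z) _ = z
        case (no nz) eq = ⊥-elim (fine (eq , nz))
    ... | yes (clash , v≢0) = repair (any? λ b → ¬? (h b ≟ v) ×-dec ¬? (g (π ⟨$⟩ʳ b) ≟ v))
      where
      a : Fin q
      a = fromℕ< k<q
      v : ℕ
      v = h a
      repair : Dec (∃[ b ] (h b ≢ v × g (π ⟨$⟩ʳ b) ≢ v)) → ∃[ π′ ] (∀ t → toℕ t < suc k → Avoids g h π′ t)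
      repair (yes (b , hb≢v , gb≢v)) = transpose a b ∘ₚ π , good′
        where
        cases : ∀ t → toℕ t < suc k → Dec (t ≡ a) → Dec (t ≡ b) → Avoids g h (transpose a b ∘ₚ π) t
        cases t _ (yes refl) _ eq = ⊥-elim (gb≢v (sym (trans eq (cong (λ x → g (π ⟨$⟩ʳ x)) (transpose-left a b)))))
        cases t _ (no _) (yes refl) eq =
          ⊥-elim (hb≢v (trans eq (trans (cong (λ x → g (π ⟨$⟩ʳ x)) (transpose-right a b)) (sym clash))))
        cases t t≤k (no t≢a) (no t≢b) eq = good t (≤∧≢⇒< (s≤s⁻¹ t≤k) λ e → t≢a (toℕ-injective (trans e (sym (toℕ-fromℕ< k<q)))))
          (trans eq (cong (λ x → g (π ⟨$⟩ʳ x)) (transpose-other t≢a t≢b)))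
        good′ : ∀ t → toℕ t < suc k → Avoids g h (transpose a b ∘ₚ π) t
        good′ t t≤k = cases t t≤k (t ≟ᶠ a) (t ≟ᶠ b)
      repair (no none) = ⊥-elim (sparse v v≢0 F F-inj F-col)
        where
        pick : ∀ b → Dec (g (π ⟨$⟩ʳ b) ≡ v) → Fin q ⊎ Fin q
        pick b (yes _) = inj₁ (π ⟨$⟩ʳ b)
        pick b (no _) = inj₂ b
        -- Without a suitable `b`, every index yields an element of colour `v`. At `a` the choice
        -- falls on `π a`, which leaves `inj₂ a` as an element number q + 1.
        F : Fin (suc q) → Fin q ⊎ Fin q
        F zero = inj₂ a
        F (suc b) = pick b (g (π ⟨$⟩ʳ b) ≟ v)
        F-col : ∀ j → [ g , h ]′ (F j) ≡ v
        F-col zero = refl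
        F-col (suc b) with g (π ⟨$⟩ʳ b) ≟ v
        ... | yes gb≡v = gb≡v
        ... | no gb≢v with h b ≟ v
        ... | yes hb≡v = hb≡v
        ... | no hb≢v = ⊥-elim (none (b , hb≢v , gb≢v))
        F-inj : Injective _≡_ _≡_ F
        F-inj {zero} {zero} _ = refl
        F-inj {zero} {suc b} eq with g (π ⟨$⟩ʳ b) ≟ v | eq
        ... | yes _ | ()
        ... | no gb≢v | refl = ⊥-elim (gb≢v (sym clash))
        F-inj {suc b} {zero} eq with g (π ⟨$⟩ʳ b) ≟ v | eq
        ... | yes _ | ()
        ... | no gb≢v | refl = ⊥-elim (gb≢v (sym clash))
        F-inj {suc b} {suc b′} eq with g (π ⟨$⟩ʳ b) ≟ v | g (π ⟨$⟩ʳ b′) ≟ v | eq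
        ... | yes _ | yes _ | e = cong suc (perm-injective π (inj₁-injective e))
        ... | no _ | no _ | e = cong suc (inj₂-injective e)
        ... | yes _ | no _ | ()
        ... | no _ | yes _ | ()
    all : ∃[ π ] (∀ t → toℕ t < q → Avoids g h π t)
    all = upTo q ≤-refl

  -- Deleting `i` and `j` leaves q indices on each side, hence the bound q although there are q + 1
  -- indices at first.
  avoidAt : (i j : Fin (suc q)) (g h : Fin (suc q) → ℕ) →
    (∀ v → v ≢ 0 → AtMost q (λ x → [ g , h ]′ x ≡ v)) →
    ∃[ π ] (π ⟨$⟩ʳ i ≡ j × (∀ t → t ≢ i → Avoids g h π t))
  avoidAt {q} i j g h sparse = insert i j π , at-i , elsewhere
    where
    embed : Fin q ⊎ Fin q → Fin (suc q) ⊎ Fin (suc q)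
    embed (inj₁ t) = inj₁ (punchIn j t)
    embed (inj₂ t) = inj₂ (punchIn i t)
    embed-inj : ∀ {x y} → embed x ≡ embed y → x ≡ y
    embed-inj {inj₁ _} {inj₁ _} eq = cong inj₁ (punchIn-injective j _ _ (inj₁-injective eq))
    embed-inj {inj₂ _} {inj₂ _} eq = cong inj₂ (punchIn-injective i _ _ (inj₂-injective eq))
    embed-col : ∀ x → [ g , h ]′ (embed x) ≡ [ g ∘ punchIn j , h ∘ punchIn i ]′ x
    embed-col (inj₁ _) = refl
    embed-col (inj₂ _) = refl
    avoided : ∃[ π ] (∀ t → Avoids (g ∘ punchIn j) (h ∘ punchIn i) π t)
    avoided = avoid (g ∘ punchIn j) (h ∘ punchIn i) λ v v≢0 f f-inj f-col →
      sparse v v≢0 (embed ∘ f) (f-inj ∘ embed-inj) (λ t → trans (embed-col (f t)) (f-col t))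
    π : Permutation′ q
    π = proj₁ avoided
    good : ∀ t → Avoids (g ∘ punchIn j) (h ∘ punchIn i) π t
    good = proj₂ avoided
    at-i : insert i j π ⟨$⟩ʳ i ≡ j
    at-i with i ≟ᶠ i
    ... | yes _ = refl
    ... | no i≢i = ⊥-elim (i≢i refl)
    elsewhere : ∀ t → t ≢ i → Avoids g h (insert i j π) t
    elsewhere t t≢i eq with i ≟ᶠ t
    ... | yes i≡t = ⊥-elim (t≢i (sym i≡t))
    ... | no i≢t = trans (cong h (sym back)) (good (punchOut i≢t) (trans (cong h back) eq))
      where
      back : punchIn i (punchOut i≢t) ≡ t
      back = punchIn-punchOut i≢t

-- Arithmetic of positions.

[r+cn]/n≡c : ∀ {r n} c .{{_ : NonZero n}} → r < n → (r + c * n) / n ≡ c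
[r+cn]/n≡c {r} {n} c r<n = trans (+-distrib-/-∣ʳ r (divides c refl))
  (cong₂ _+_ (m<n⇒m/n≡0 r<n) (m*n/n≡m c n))

[r+cn]%n≡r : ∀ {r n} c .{{_ : NonZero n}} → r < n → (r + c * n) % n ≡ r
[r+cn]%n≡r {r} {n} c r<n = trans ([m+kn]%n≡m%n r c n) (m<n⇒m%n≡m r<n)

-- Level `i` stands for i + 1 filled rows. The quotient is the column of `p`; adding it re-encodes
-- the same cell for columns of height i + 2.
shift : ℕ → ℕ → ℕ
shift i p = p + p / suc i

shift-cell : ∀ i {r} c → r ≤ i → shift i (r + c * suc i) ≡ r + c * (2 + i)
shift-cell i {r} c r≤i = trans (cong (r + c * suc i +_) ([r+cn]/n≡c c (s≤s r≤i))) (ring r c i)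
  where
  ring : ∀ r c i → r + c * suc i + c ≡ r + c * (2 + i)
  ring = solve-∀

shift≡cell : ∀ i p → shift i p ≡ p % suc i + p / suc i * (2 + i)
shift≡cell i p = trans (cong (shift i) (m≡m%n+[m/n]*n p (suc i))) (shift-cell i (p / suc i) (s≤s⁻¹ (m%n<n p (suc i))))

shift-column : ∀ i p → shift i p / (2 + i) ≡ p / suc i
shift-column i p = trans (cong (_/ (2 + i)) (shift≡cell i p)) ([r+cn]/n≡c (p / suc i) (m<n⇒m<1+n (m%n<n p (suc i))))

-- Residue i + 1 is never attained: these are the cells that the new row adds to the columns.
shift-residue : ∀ i p → shift i p % (2 + i) < suc i
shift-residue i p = ≤-<-trans (≤-reflexive (trans (cong (_% (2 + i)) (shift≡cell i p))
  ([r+cn]%n≡r (p / suc i) (m<n⇒m<1+n (m%n<n p (suc i)))))) (m%n<n p (suc i))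

shift-mono-< : ∀ i {p p′} → p < p′ → shift i p < shift i p′
shift-mono-< i p<p′ = +-mono-<-≤ p<p′ (/-monoˡ-≤ (suc i) (<⇒≤ p<p′))

shift-injective : ∀ i → Injective _≡_ _≡_ (shift i)
shift-injective i {p} {p′} eq with <-cmp p p′
... | tri< lt _ _ = ⊥-elim (<-irrefl eq (shift-mono-< i lt))
... | tri≈ _ e _ = e
... | tri> _ _ gt = ⊥-elim (<-irrefl (sym eq) (shift-mono-< i gt))

flipIf : ∀ {n} → Bool → Fin n → Fin n
flipIf false c = c
flipIf true c = opposite c

flipIf-involutive : ∀ {n} d (c : Fin n) → flipIf d (flipIf d c) ≡ c
flipIf-involutive false c = refl
flipIf-involutive true c = opposite-involutive c

flipIf-injective : ∀ {n} d → Injective _≡_ _≡_ (flipIf {n} d)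
flipIf-injective d {x} {y} eq = trans (sym (flipIf-involutive d x)) (trans (cong (flipIf d) eq) (flipIf-involutive d y))

-- The time of the next move.

module Process (N : ℕ) where

  -- If p + k < N, the bound on N forces p < (k + 1)(i + 1), so the shift adds at most k and stays
  -- below N. With `high⇒top`, for k = ⌊N/(i + 2)⌋, the positions that overflow are exactly the last
  -- k.
  top⇒high : ∀ i k p → N < (2 + i) * suc k → N ≤ shift i p → N ≤ p + k
  top⇒high i k p N<  top with N ≤? p + k
  ... | yes h = h
  ... | no low = ⊥-elim (≤⇒≯ top (≤-<-trans (+-monoʳ-≤ p (s≤s⁻¹ (m<n*o⇒m/o<n p<))) (≰⇒> low)))
    where
    p< : p < suc k * suc i
    p< = +-cancelʳ-< (suc k) p (suc k * suc i) (begin-strict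
      p + suc k           ≡⟨ +-suc p k ⟩
      suc (p + k)         ≤⟨ ≰⇒> low ⟩
      N                   <⟨ N< ⟩
      (2 + i) * suc k     ≡⟨ ring i k ⟩
      suc k * suc i + suc k ∎)
      where
      open ≤-Reasoning
      ring : ∀ i k → (2 + i) * suc k ≡ suc k * suc i + suc k
      ring = solve-∀

  high⇒top : ∀ i k p → (2 + i) * k ≤ N → N ≤ p + k → N ≤ shift i p
  high⇒top i k p k≤ high = ≤-trans high (+-monoʳ-≤ p (≤-trans (≤-reflexive (sym (m*n/n≡m k (suc i)))) (/-monoˡ-≤ (suc i) ki≤p)))
    where
    ki≤p : k * suc i ≤ p
    ki≤p = +-cancelʳ-≤ k (k * suc i) p (≤-trans (≤-reflexive (ring k i)) (≤-trans k≤ high))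
      where
      ring : ∀ k i → k * suc i + k ≡ (2 + i) * k
      ring = solve-∀

  -- τ i f p records when a symbol in position p after i + 1 rows is next moved, as the
  -- number of rows then left to fill; it is 0 if this does not happen within f rows.
  τ : ℕ → ℕ → ℕ → ℕ
  τ′ : ∀ i f p → Dec (N ≤ shift i p) → ℕ
  τ i zero p = 0
  τ i (suc f) p = τ′ i f p (N ≤? shift i p)
  τ′ i f p (yes _) = suc f
  τ′ i f p (no _) = τ (suc i) f (shift i p)

  τ-top : ∀ i f p → N ≤ shift i p → τ i (suc f) p ≡ suc f
  τ-top i f p top with N ≤? shift i p
  ... | yes _ = refl
  ... | no ¬top = ⊥-elim (¬top top)

  τ-low : ∀ i f p → shift i p < N → τ i (suc f) p ≡ τ (suc i) f (shift i p)
  τ-low i f p low with N ≤? shift i p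
  ... | yes top = ⊥-elim (<⇒≱ low top)
  ... | no _ = refl

  τ≤fuel : ∀ i f p → τ i f p ≤ f
  τ≤fuel i zero p = z≤n
  τ≤fuel i (suc f) p with N ≤? shift i p
  ... | yes _ = ≤-refl
  ... | no _ = m≤n⇒m≤1+n (τ≤fuel (suc i) f (shift i p))

  -- Positions with the largest colour overflow now, so they are among the last k. Those with a
  -- smaller colour survive, and the injective `shift` takes them to the next level, where the
  -- hypothesis ⌊N/(i + 2)⌋ ≤ k only becomes weaker.
  τ-atMost : ∀ f i k v → v ≢ 0 → N < (2 + i) * suc k → AtMost k (λ p → p < N × τ i f p ≡ v)
  τ-atMost zero i k v v≢0 _ p _ col = v≢0 (sym (proj₂ (col zero)))
  τ-atMost (suc f) i k v v≢0 N< p p-inj col with v ≟ suc f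
  -- The distance from the last position embeds the k + 1 positions into k values.
  ... | yes refl = 1+n≰n (injective⇒≤ {f = λ j → fromℕ< (below j)} λ {j} {j′} eq →
    p-inj (flip-inj (proj₁ (col j)) (proj₁ (col j′))
      (trans (sym (toℕ-fromℕ< (below j))) (trans (cong toℕ eq) (toℕ-fromℕ< (below j′))))))
    where
    top : ∀ j → N ≤ shift i (p j)
    top j with N ≤? shift i (p j)
    ... | yes t = t
    ... | no ¬t = ⊥-elim (1+n≰n (≤-trans (≤-reflexive (sym (trans (sym (τ-low i f (p j) (≰⇒> ¬t))) (proj₂ (col j))))) (τ≤fuel (suc i) f (shift i (p j)))))
    below : ∀ j → N ∸ suc (p j) < k
    below j = +-cancelʳ-< (p j) _ _ (begin-strict
      N ∸ suc (p j) + p j       <⟨ n<1+n _ ⟩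
      suc (N ∸ suc (p j) + p j) ≡⟨ +-suc (N ∸ suc (p j)) (p j) ⟨
      N ∸ suc (p j) + suc (p j) ≡⟨ m∸n+n≡m (proj₁ (col j)) ⟩
      N                         ≤⟨ top⇒high i k (p j) N< (top j) ⟩
      p j + k                   ≡⟨ +-comm (p j) k ⟩
      k + p j                   ∎)
      where open ≤-Reasoning
    flip-inj : ∀ {a b} → a < N → b < N → N ∸ suc a ≡ N ∸ suc b → a ≡ b
    flip-inj a<N b<N eq = cong pred (∸-cancelˡ-≡ a<N b<N eq)
  ... | no v≢ = τ-atMost f (suc i) k v v≢0 (<-≤-trans N< (*-monoˡ-≤ (suc k) (n≤1+n (2 + i))))
    (shift i ∘ p) (p-inj ∘ shift-injective i) (λ j → low j , trans (sym (τ-low i f (p j) (low j))) (proj₂ (col j)))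
    where
    low : ∀ j → shift i (p j) < N
    low j with N ≤? shift i (p j)
    ... | yes t = ⊥-elim (v≢ (trans (sym (proj₂ (col j))) (τ-top i f (p j) t)))
    ... | no ¬t = ≰⇒> ¬t

  -- After i + 1 rows, with f rows of the upper half still to come; false is the left side.
  record State (i f : ℕ) : Set where
    field
      pos : Bool → Permutation′ N
    P : Bool → Fin N → ℕ
    P d s = toℕ (pos d ⟨$⟩ʳ s)
    field
      noClash : ∀ d s → τ i f (P d s) ≡ τ i f (P (not d) s) → τ i f (P d s) ≡ 0
    P<N : ∀ d s → P d s < N
    P<N d s = toℕ<n (pos d ⟨$⟩ʳ s)
    P-inj : ∀ d {s s′} → P d s ≡ P d s′ → s ≡ s′
    P-inj d eq = perm-injective (pos d) (toℕ-injective eq)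

  -- One step: a new row serving both upper corners.

  module Step {i f : ℕ} (st : State i (suc f)) (q : ℕ) (q≤ : (2 + i) * q ≤ N) (N< : N < (2 + i) * suc q) where
    open State st

    q≤N : q ≤ N
    q≤N = ≤-trans (m≤m+n q _) q≤

    q+q≤N : q + q ≤ N
    q+q≤N = ≤-trans (≤-trans (m≤m+n (q + q) (i * q)) (≤-reflexive (+-assoc q q (i * q)))) q≤

    topPos : Fin q → Fin N
    topPos j = fromℕ< {N ∸ q + toℕ j} (<-≤-trans (+-monoʳ-< (N ∸ q) (toℕ<n j)) (≤-reflexive (m∸n+n≡m q≤N)))

    topSym : Bool → Fin q → Fin N
    topSym d j = pos d ⟨$⟩ˡ topPos j

    P-topSym : ∀ d j → P d (topSym d j) ≡ N ∸ q + toℕ j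
    P-topSym d j = trans (cong toℕ (inverseʳ (pos d))) (toℕ-fromℕ< _)

    topSym-isTop : ∀ d j → N ≤ shift i (P d (topSym d j))
    topSym-isTop d j = high⇒top i q _ q≤ (begin
      N                       ≡⟨ m∸n+n≡m q≤N ⟨
      N ∸ q + q               ≤⟨ +-monoˡ-≤ q (≤-trans (m≤m+n (N ∸ q) (toℕ j)) (≤-reflexive (sym (P-topSym d j)))) ⟩
      P d (topSym d j) + q    ∎)
      where open ≤-Reasoning

    topSym-injective : ∀ d → Injective _≡_ _≡_ (topSym d)
    topSym-injective d {j} {j′} eq = toℕ-injective (+-cancelˡ-≡ (N ∸ q) _ _
      (trans (sym (P-topSym d j)) (trans (cong (P d) eq) (P-topSym d j′))))

    isTop⇒topSym : ∀ d s → N ≤ shift i (P d s) → ∃[ j ] topSym d j ≡ s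
    isTop⇒topSym d s top = j , P-inj d (trans (P-topSym d j) (trans (cong (N ∸ q +_) (toℕ-fromℕ< j<q)) (m+[n∸m]≡n N∸q≤)))
      where
      N∸q≤ : N ∸ q ≤ P d s
      N∸q≤ = ≤-trans (∸-monoˡ-≤ q (top⇒high i q (P d s) N< top)) (≤-reflexive (m+n∸n≡m (P d s) q))
      j<q : P d s ∸ (N ∸ q) < q
      j<q = +-cancelʳ-< (N ∸ q) _ q (begin-strict
        P d s ∸ (N ∸ q) + (N ∸ q) ≡⟨ m∸n+n≡m N∸q≤ ⟩
        P d s                     <⟨ P<N d s ⟩
        N                         ≡⟨ m+[n∸m]≡n q≤N ⟨
        q + (N ∸ q)               ∎)
        where open ≤-Reasoning
      j = fromℕ< j<q

    -- Moving now is the nonzero colour `suc f`; on both sides at once it would contradict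
    -- `noClash`.
    top-oneSided : ∀ d s → N ≤ shift i (P d s) → shift i (P (not d) s) < N
    top-oneSided d s top with N ≤? shift i (P (not d) s)
    ... | no low = ≰⇒> low
    ... | yes top′ with trans (sym (τ-top i f _ top)) (noClash d s (trans (τ-top i f _ top) (sym (τ-top i f _ top′))))
    ... | ()

    -- The cell of the new row in column `t`, that is, the position of residue i + 1 modulo i + 2.
    slot : Fin q → ℕ
    slot t = suc i + toℕ t * (2 + i)

    slot-column : ∀ t → slot t / (2 + i) ≡ toℕ t
    slot-column t = [r+cn]/n≡c {suc i} (toℕ t) ≤-refl

    slot-injective : Injective _≡_ _≡_ slot
    slot-injective {t} {t′} eq = toℕ-injective (trans (sym (slot-column t)) (trans (cong (_/ (2 + i)) eq) (slot-column t′)))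

    slot<N : ∀ t → slot t < N
    slot<N t = ≤-trans (*-monoˡ-≤ (2 + i) (toℕ<n t)) (≤-trans (≤-reflexive (*-comm q (2 + i))) q≤)

    slot≢shift : ∀ t p → slot t ≢ shift i p
    slot≢shift t p eq = <-irrefl (trans (sym (cong (_% (2 + i)) eq)) ([r+cn]%n≡r (toℕ t) ≤-refl)) (shift-residue i p)

    slotColour : Fin q → ℕ
    slotColour t = τ (suc i) f (slot t)

    symColour : Bool → Fin q → ℕ
    symColour d j = τ (suc i) f (shift i (P (not d) (topSym d j)))

    -- The free slots and the positions, seen from the other side, of the symbols moved
    -- from this side are distinct positions of one and the same next level.
    colours-sparse : ∀ d k → N < (3 + i) * suc k → ∀ v → v ≢ 0 →
      AtMost k (λ x → [ slotColour , symColour d ]′ x ≡ v)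
    colours-sparse d k k< v v≢0 F F-inj F-col =
      τ-atMost f (suc i) k v v≢0 k< (place ∘ F) (λ eq → F-inj (place-inj _ _ eq))
        (λ j → place<N (F j) , trans (place-colour (F j)) (F-col j))
      where
      place : Fin q ⊎ Fin q → ℕ
      place (inj₁ t) = slot t
      place (inj₂ j) = shift i (P (not d) (topSym d j))
      place<N : ∀ x → place x < N
      place<N (inj₁ t) = slot<N t
      place<N (inj₂ j) = top-oneSided d (topSym d j) (topSym-isTop d j)
      place-colour : ∀ x → τ (suc i) f (place x) ≡ [ slotColour , symColour d ]′ x
      place-colour (inj₁ _) = refl
      place-colour (inj₂ _) = refl
      place-inj : ∀ x y → place x ≡ place y → x ≡ y
      place-inj (inj₁ t) (inj₁ t′) eq = cong inj₁ (slot-injective eq)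
      place-inj (inj₁ t) (inj₂ j) eq = ⊥-elim (slot≢shift t (P (not d) (topSym d j)) eq)
      place-inj (inj₂ j) (inj₁ t) eq = ⊥-elim (slot≢shift t (P (not d) (topSym d j)) (sym eq))
      place-inj (inj₂ j) (inj₂ j′) eq = cong inj₂ (topSym-injective d (P-inj (not d) (shift-injective i eq)))

    module Move (π : Bool → Permutation′ q) (good : ∀ d j → Avoids slotColour (symColour d) (π d) j) where

      -- Either the symbol survives in its column, or it overflows and takes the free slot that
      -- `π d` assigns to it.
      Position : Bool → Fin N → ℕ → Set
      Position d s p = (shift i (P d s) < N × p ≡ shift i (P d s)) ⊎ (∃[ j ] (topSym d j ≡ s × p ≡ slot (π d ⟨$⟩ʳ j)))

      position : ∀ d s → ∃[ p ] Position d s p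
      position d s with N ≤? shift i (P d s)
      ... | no low = _ , inj₁ (≰⇒> low , refl)
      ... | yes top = _ , inj₂ (proj₁ (isTop⇒topSym d s top) , proj₂ (isTop⇒topSym d s top) , refl)

      Position<N : ∀ {d s p} → Position d s p → p < N
      Position<N (inj₁ (low , refl)) = low
      Position<N {d} (inj₂ (j , _ , refl)) = slot<N (π d ⟨$⟩ʳ j)

      Position-injective : ∀ {d s s′ p} → Position d s p → Position d s′ p → s ≡ s′
      Position-injective {d} (inj₁ (_ , refl)) (inj₁ (_ , eq)) = P-inj d (shift-injective i eq)
      Position-injective {d} {s} (inj₁ (_ , refl)) (inj₂ (j , _ , eq)) = ⊥-elim (slot≢shift (π d ⟨$⟩ʳ j) (P d s) (sym eq))
      Position-injective {d} {s} {s′} (inj₂ (j , _ , refl)) (inj₁ (_ , eq)) = ⊥-elim (slot≢shift (π d ⟨$⟩ʳ j) (P d s′) eq)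
      Position-injective {d} (inj₂ (j , refl , refl)) (inj₂ (j′ , refl , eq)) =
        cong (topSym d) (perm-injective (π d) (slot-injective eq))

      newPos : Bool → Fin N → Fin N
      newPos d s = fromℕ< (Position<N {d} {s} (proj₂ (position d s)))

      newPos-spec : ∀ d s → Position d s (toℕ (newPos d s))
      newPos-spec d s = subst (Position d s) (sym (toℕ-fromℕ< _)) (proj₂ (position d s))

      newPos-injective : ∀ d → Injective _≡_ _≡_ (newPos d)
      newPos-injective d {s} {s′} eq = Position-injective {d}
        (newPos-spec d s) (subst (Position d s′ ∘ toℕ) (sym eq) (newPos-spec d s′))

      low⇒newPos : ∀ d s → shift i (P d s) < N → toℕ (newPos d s) ≡ shift i (P d s)
      low⇒newPos d s low = cases (newPos-spec d s)
        where
        cases : ∀ {p} → Position d s p → p ≡ shift i (P d s)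
        cases (inj₁ (_ , eq)) = eq
        cases (inj₂ (j , refl , _)) = ⊥-elim (<⇒≱ low (topSym-isTop d j))

      topSym-newPos : ∀ d s j → topSym d j ≡ s → toℕ (newPos d s) ≡ slot (π d ⟨$⟩ʳ j)
      topSym-newPos d s j eq = cases (newPos-spec d s)
        where
        cases : ∀ {p} → Position d s p → p ≡ slot (π d ⟨$⟩ʳ j)
        cases (inj₁ (low , _)) = ⊥-elim (<⇒≱ low (subst (λ s → N ≤ shift i (P d s)) eq (topSym-isTop d j)))
        cases (inj₂ (j′ , eq′ , p≡)) = trans p≡ (cong (λ x → slot (π d ⟨$⟩ʳ x)) (topSym-injective d (trans eq′ (sym eq))))

      next : State (suc i) f
      next = record
        { pos = λ d → injective⇒permutation (newPos d) (newPos-injective d)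
        ; noClash = λ d s → clash d s (N ≤? shift i (P d s)) (N ≤? shift i (P (not d) s)) }
        where
        colour : Bool → Fin N → ℕ
        colour d s = τ (suc i) f (toℕ (newPos d s))
        -- A symbol moved on side `d` keeps its colour on the other side, and that is the colour
        -- which `good` separates from the colour of its new slot.
        oneTop : ∀ d s → N ≤ shift i (P d s) → colour (not d) s ≡ colour d s → colour (not d) s ≡ 0
        oneTop d s top eq = trans low (good d j (trans (sym low) (trans eq (cong (τ (suc i) f) (topSym-newPos d s j s≡)))))
          where
          j = proj₁ (isTop⇒topSym d s top)
          s≡ = proj₂ (isTop⇒topSym d s top)
          low : colour (not d) s ≡ symColour d j
          low = cong (τ (suc i) f) (trans (low⇒newPos (not d) s (top-oneSided d s top)) (cong (shift i ∘ P (not d)) (sym s≡)))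
        clash : ∀ d s → Dec (N ≤ shift i (P d s)) → Dec (N ≤ shift i (P (not d) s)) →
          colour d s ≡ colour (not d) s → colour d s ≡ 0
        clash d s (yes top) (yes top′) _ = ⊥-elim (<⇒≱ (top-oneSided d s top) top′)
        clash d s (no low) (no low′) eq = trans (same d (≰⇒> low))
          (noClash d s (trans (sym (same d (≰⇒> low))) (trans eq (same (not d) (≰⇒> low′)))))
          where
          same : ∀ d → shift i (P d s) < N → τ (suc i) f (toℕ (newPos d s)) ≡ τ i (suc f) (P d s)
          same d low = trans (cong (τ (suc i) f) (low⇒newPos d s low)) (sym (τ-low i f (P d s) low))
        clash d s (yes top) (no low) eq = trans eq (oneTop d s top (sym eq))
        clash d s (no low) (yes top) eq = subst (λ d′ → colour d′ s ≡ 0) (not-involutive d)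
          (oneTop (not d) s top (subst (λ d′ → colour d′ s ≡ colour (not d) s) (sym (not-involutive d)) eq))

      column : Bool → Fin q → Fin N
      column d t = flipIf d (inject≤ t q≤N)

      column-injective : ∀ {d d′ t t′} → column d t ≡ column d′ t′ → (d , t) ≡ (d′ , t′)
      column-injective {d} {d′} {t} {t′} eq = cases d d′ eq
        where
        same : ∀ d → column d t ≡ column d t′ → (d , t) ≡ (d , t′)
        same d eq = cong (d ,_) (toℕ-injective (trans (sym (toℕ-inject≤ t q≤N))
          (trans (cong toℕ (flipIf-injective d eq)) (toℕ-inject≤ t′ q≤N))))
        apart : ∀ (t t′ : Fin q) → column false t ≡ column true t′ → ⊥
        apart t t′ eq = <-irrefl N≡ (<-≤-trans (+-mono-<-≤ (toℕ<n t) (toℕ<n t′)) q+q≤N)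
          where
          t≡ : toℕ t ≡ N ∸ suc (toℕ t′)
          t≡ = trans (sym (toℕ-inject≤ t q≤N)) (trans (cong toℕ eq)
            (trans (opposite-prop (inject≤ t′ q≤N)) (cong (λ x → N ∸ suc x) (toℕ-inject≤ t′ q≤N))))
          N≡ : toℕ t + suc (toℕ t′) ≡ N
          N≡ = trans (cong (_+ suc (toℕ t′)) t≡) (m∸n+n≡m (≤-trans (toℕ<n t′) q≤N))
        cases : ∀ d d′ → column d t ≡ column d′ t′ → (d , t) ≡ (d′ , t′)
        cases false false eq = same false eq
        cases true true eq = same true eq
        cases false true eq = ⊥-elim (apart t t′ eq)
        cases true false eq = ⊥-elim (apart t′ t (sym eq))

      symbol : Bool → Fin q → Fin N
      symbol d t = topSym d (π d ⟨$⟩ˡ t)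

      symbol-injective : ∀ {d d′ t t′} → symbol d t ≡ symbol d′ t′ → (d , t) ≡ (d′ , t′)
      symbol-injective {d} {d′} {t} {t′} eq = cases d d′ eq
        where
        apart : ∀ d t t′ → symbol d t ≡ symbol (not d) t′ → ⊥
        apart d t t′ eq = <⇒≱ (top-oneSided d (symbol d t) (topSym-isTop d _))
          (≤-trans (topSym-isTop (not d) _) (≤-reflexive (cong (shift i ∘ P (not d)) (sym eq))))
        cases : ∀ d d′ → symbol d t ≡ symbol d′ t′ → (d , t) ≡ (d′ , t′)
        cases false false eq = cong (false ,_) (perm⁻¹-injective (π false) (topSym-injective false eq))
        cases true true eq = cong (true ,_) (perm⁻¹-injective (π true) (topSym-injective true eq))
        cases false true eq = ⊥-elim (apart false t t′ eq)
        cases true false eq = ⊥-elim (apart true t t′ eq)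

      newRow : ∃[ ρ ] (∀ d t → ρ ⟨$⟩ʳ column d t ≡ symbol d t)
      newRow = extendTwoSided column symbol column-injective symbol-injective

      row : Permutation′ N
      row = proj₁ newRow

      top⇒row : ∀ d s → N ≤ shift i (P d s) → ∃[ c ] (toℕ c ≡ toℕ (newPos d s) / (2 + i) × row ⟨$⟩ʳ flipIf d c ≡ s)
      top⇒row d s top = inject≤ (π d ⟨$⟩ʳ j) q≤N
        , trans (toℕ-inject≤ _ q≤N) (trans (sym (slot-column _)) (cong (_/ (2 + i)) (sym (topSym-newPos d s j s≡))))
        , trans (proj₂ newRow d (π d ⟨$⟩ʳ j)) (trans (cong (topSym d) (inverseˡ (π d))) s≡)
        where
        j = proj₁ (isTop⇒topSym d s top)
        s≡ = proj₂ (isTop⇒topSym d s top)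

      -- The outer q columns on side `d` hold only symbols that overflow on that side. When N = 2q +
      -- 1 this leaves just the middle column.
      low⇒inner : ∀ s → (∀ d → shift i (P d s) < N) → ∀ d → q ≤ toℕ (flipIf d (row ⟨$⟩ˡ s))
      low⇒inner s low d = ≮⇒≥ λ c<q → <⇒≱ (low d)
        (subst (λ s → N ≤ shift i (P d s)) (atColumn c<q) (topSym-isTop d (π d ⟨$⟩ˡ fromℕ< c<q)))
        where
        c = row ⟨$⟩ˡ s
        atColumn : (c<q : toℕ (flipIf d c) < q) → symbol d (fromℕ< c<q) ≡ s
        atColumn c<q = begin
          symbol d (fromℕ< c<q)             ≡⟨ proj₂ newRow d (fromℕ< c<q) ⟨
          row ⟨$⟩ʳ column d (fromℕ< c<q)    ≡⟨ cong (λ x → row ⟨$⟩ʳ flipIf d x) (toℕ-injective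
                                                 (trans (toℕ-inject≤ (fromℕ< c<q) q≤N) (toℕ-fromℕ< c<q))) ⟩
          row ⟨$⟩ʳ flipIf d (flipIf d c)    ≡⟨ cong (row ⟨$⟩ʳ_) (flipIf-involutive d c) ⟩
          row ⟨$⟩ʳ c                        ≡⟨ inverseʳ row ⟩
          s                                 ∎
          where open ≡-Reasoning

[m/n]-spec : ∀ m n .{{_ : NonZero n}} → n * (m / n) ≤ m × m < n * suc (m / n)
[m/n]-spec m n = ≤-trans (≤-reflexive (*-comm n (m / n))) (m/n*n≤m m n) , (begin-strict
  m                       ≡⟨ m≡m%n+[m/n]*n m n ⟩
  m % n + m / n * n       <⟨ +-monoˡ-< (m / n * n) (m%n<n m n) ⟩
  n + m / n * n           ≡⟨ *-comm (suc (m / n)) n ⟩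
  n * suc (m / n)         ∎)
  where open ≤-Reasoning

update : {A : Set} → ℕ → A → (ℕ → A) → ℕ → A
update k a f r with r ≟ k
... | yes _ = a
... | no _ = f r

update-here : {A : Set} (k : ℕ) (a : A) (f : ℕ → A) → update k a f k ≡ a
update-here k a f with k ≟ k
... | yes _ = refl
... | no k≢k = ⊥-elim (k≢k refl)

update-there : {A : Set} {k r : ℕ} (a : A) (f : ℕ → A) → r ≢ k → update k a f r ≡ f r
update-there {k = k} {r} a f r≢k with r ≟ k
... | yes r≡k = ⊥-elim (r≢k r≡k)
... | no _ = refl

-- Iterating the steps.

module Running (N : ℕ) where
  open Process N

  Shows : Permutation′ N → Bool → Fin N → ℕ → Set
  Shows row d s c = ∃[ k ] (toℕ k ≡ c × row ⟨$⟩ʳ flipIf d k ≡ s)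

  -- `poss k` holds the positions at level k. By `covers`, a symbol has been shown in its column by
  -- a row after row i, or that column is still the one of level i. `keep` follows a cell whose
  -- place stays below N up to level M, so that its symbol never moves.
  record Run (M : ℕ) {i f : ℕ} (st : State i f) : Set where
    open State st
    field
      rows : ℕ → Permutation′ N
      poss : ℕ → Bool → Permutation′ N
      covers : ∀ k → i ≤ k → k ≤ M → ∀ d s →
        (∃[ r ] (i < r × r ≤ k × Shows (rows r) d s (toℕ (poss k d ⟨$⟩ʳ s) / suc k)))
        ⊎ toℕ (poss k d ⟨$⟩ʳ s) / suc k ≡ P d s / suc i
      keep : ∀ d s r c → r ≤ i → P d s ≡ r + c * suc i → r + c * suc M < N →
        toℕ (poss M d ⟨$⟩ʳ s) ≡ r + c * suc M

  stepRun : ∀ {M i f} (st : State i (suc f)) q q≤ N< → let open Step {i} {f} st q q≤ N< in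
    (π : Bool → Permutation′ q) (good : ∀ d j → Avoids slotColour (symColour d) (π d) j) →
    suc i ≤ M → Run M (Move.next π good) → Run M st
  stepRun {M} {i} {f} st q q≤ N< π good i<M R = record { rows = rows ; poss = poss ; covers = covers ; keep = keep }
    where
    open State st
    open Step {i} {f} st q q≤ N<
    open Move π good
    rows = update (suc i) row (Run.rows R)
    poss = update i pos (Run.poss R)
    movedOrNot : ∀ d s → Dec (N ≤ shift i (P d s)) →
      Shows row d s (toℕ (newPos d s) / (2 + i)) ⊎ toℕ (newPos d s) / (2 + i) ≡ P d s / suc i
    movedOrNot d s (yes top) = inj₁ (top⇒row d s top)
    movedOrNot d s (no low) =
      inj₂ (trans (cong (_/ (2 + i)) (low⇒newPos d s (≰⇒> low))) (shift-column i (P d s)))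
    covers : ∀ k → i ≤ k → k ≤ M → ∀ d s →
        (∃[ r ] (i < r × r ≤ k × Shows (rows r) d s (toℕ (poss k d ⟨$⟩ʳ s) / suc k)))
        ⊎ toℕ (poss k d ⟨$⟩ʳ s) / suc k ≡ P d s / suc i
    covers k i≤k k≤M d s with m≤n⇒m<n∨m≡n i≤k
    ... | inj₂ refl rewrite update-here i pos (Run.poss R) = inj₂ refl
    ... | inj₁ i<k rewrite update-there pos (Run.poss R) (>⇒≢ i<k) with Run.covers R k i<k k≤M d s
    ...   | inj₁ (r , i<r , r≤k , shows) = inj₁ (r , <-trans (n<1+n i) i<r , r≤k ,
              subst (λ ρ → Shows ρ d s _) (sym (update-there row (Run.rows R) (>⇒≢ i<r))) shows)
    ...   | inj₂ col with movedOrNot d s (N ≤? shift i (P d s))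
    ...     | inj₁ shows = inj₁ (suc i , ≤-refl , i<k ,
                subst (λ ρ → Shows ρ d s _) (sym (update-here (suc i) row (Run.rows R)))
                  (subst (Shows row d s) (sym col) shows))
    ...     | inj₂ same = inj₂ (trans col same)
    keep : ∀ d s r c → r ≤ i → P d s ≡ r + c * suc i → r + c * suc M < N →
        toℕ (poss M d ⟨$⟩ʳ s) ≡ r + c * suc M
    keep d s r c r≤i P≡ small rewrite update-there pos (Run.poss R) (>⇒≢ i<M) =
      Run.keep R d s r c (m≤n⇒m≤1+n r≤i) (trans (low⇒newPos d s low) shift≡) small
      where
      shift≡ : shift i (P d s) ≡ r + c * (2 + i)
      shift≡ = trans (cong (shift i) P≡) (shift-cell i c r≤i)
      low : shift i (P d s) < N
      low = ≤-<-trans (≤-trans (≤-reflexive shift≡) (+-monoʳ-≤ r (*-monoʳ-≤ c (s≤s i<M)))) small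

  abstract
    run : ∀ f i M → i + f ≡ M → (st : State i f) → Run M st
    run zero i M eq st = record
      -- A default: at the last level no row after row i is called for.
      { rows = λ _ → idₚ
      ; poss = λ _ → pos
      ; covers = λ k i≤k k≤M d s → inj₂ (/-congʳ {m = P d s} (cong suc (≤-antisym (≤-trans k≤M (≤-reflexive (sym i≡M))) i≤k)))
      ; keep = λ d s r c _ P≡ _ → trans P≡ (cong (λ x → r + c * suc x) i≡M) }
      where
      open State st
      i≡M : i ≡ M
      i≡M = trans (sym (+-identityʳ i)) eq
    run (suc f) i M eq st = stepRun st quot q≤ N< (λ d → proj₁ (avoided d)) (λ d → proj₂ (avoided d))
      (≤-trans (m≤m+n (suc i) f) (≤-reflexive eq′)) (run f (suc i) M eq′ _)
      where
      eq′ : suc i + f ≡ M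
      eq′ = trans (sym (+-suc i f)) eq
      quot : ℕ
      quot = N / (2 + i)
      q≤ : (2 + i) * quot ≤ N
      q≤ = proj₁ ([m/n]-spec N (2 + i))
      N< : N < (2 + i) * suc quot
      N< = proj₂ ([m/n]-spec N (2 + i))
      open Step {i} {f} st quot q≤ N<
      avoided : ∀ d → ∃[ π ] (∀ j → Avoids slotColour (symColour d) π j)
      -- The bound for the next level, ⌊N/(i + 3)⌋, does not exceed the number ⌊N/(i + 2)⌋ of slots.
      avoided d = avoid slotColour (symColour d)
        (colours-sparse d quot (<-≤-trans N< (*-monoˡ-≤ (suc quot) (n≤1+n (2 + i)))))

-- Column classes and the involution of the symbols.

data Cls : Set where
  S B X : Cls

-- A symbol must lie in an outer column in exactly one of the two halves; those of class `X` are
-- left to the middle row.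
swapCls : Cls → Cls
swapCls S = B
swapCls B = S
swapCls X = X

swapCls-involutive : ∀ a → swapCls (swapCls a) ≡ a
swapCls-involutive S = refl
swapCls-involutive B = refl
swapCls-involutive X = refl

-- Whether, after m rows, a position lies in the outermost column, in the next one or beyond.
cls : ℕ → ℕ → Cls
cls m p with p <? m | p <? m + m
... | yes _ | _ = S
... | no _ | yes _ = B
... | no _ | no _ = X

module _ {m p : ℕ} where

  cls-S : p < m → cls m p ≡ S
  cls-S p<m with p <? m
  ... | yes _ = refl
  ... | no p≮m = ⊥-elim (p≮m p<m)

  cls-B : m ≤ p → p < m + m → cls m p ≡ B
  cls-B m≤p p<2m with p <? m | p <? m + m
  ... | yes p<m | _ = ⊥-elim (<⇒≱ p<m m≤p)
  ... | no _ | yes _ = refl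
  ... | no _ | no p≮2m = ⊥-elim (p≮2m p<2m)

  cls-X : m + m ≤ p → cls m p ≡ X
  cls-X 2m≤p with p <? m | p <? m + m
  ... | yes p<m | _ = ⊥-elim (<⇒≱ p<m (≤-trans (m≤m+n m m) 2m≤p))
  ... | no _ | yes p<2m = ⊥-elim (<⇒≱ p<2m 2m≤p)
  ... | no _ | no _ = refl

  cls-S⁻¹ : cls m p ≡ S → p < m
  cls-S⁻¹ eq with p <? m | p <? m + m
  cls-S⁻¹ refl | yes p<m | _ = p<m
  cls-S⁻¹ () | no _ | yes _
  cls-S⁻¹ () | no _ | no _

  cls-B⁻¹ : cls m p ≡ B → m ≤ p × p < m + m
  cls-B⁻¹ eq with p <? m | p <? m + m
  cls-B⁻¹ () | yes _ | _
  cls-B⁻¹ refl | no p≮m | yes p<2m = ≮⇒≥ p≮m , p<2m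
  cls-B⁻¹ () | no _ | no _

  cls-X⁻¹ : cls m p ≡ X → m + m ≤ p
  cls-X⁻¹ eq with p <? m | p <? m + m
  cls-X⁻¹ () | yes _ | _
  cls-X⁻¹ () | no _ | yes _
  cls-X⁻¹ refl | no _ | no p≮2m = ≮⇒≥ p≮2m

classAt : ∀ {N} m → (Bool → Permutation′ N) → Bool → Fin N → Cls
classAt m pos d s = cls m (toℕ (pos d ⟨$⟩ʳ s))

module Reflection {N m : ℕ} (2m≤N : m + m ≤ N) (pos : Bool → Permutation′ N) where

  P : Bool → Fin N → ℕ
  P d s = toℕ (pos d ⟨$⟩ʳ s)

  P-inj : ∀ d {s s′} → P d s ≡ P d s′ → s ≡ s′
  P-inj d eq = perm-injective (pos d) (toℕ-injective eq)

  class : Bool → Fin N → Cls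
  class = classAt m pos

  -- The involution has to carry the symbols `inS` of the outermost left column onto the symbols
  -- `inB` of the second column on the right.
  inS : Fin m → Fin N
  inS j = pos false ⟨$⟩ˡ inject≤ j (≤-trans (m≤m+n m m) 2m≤N)

  inB : Fin m → Fin N
  inB j = pos true ⟨$⟩ˡ fromℕ< {m + toℕ j} (<-≤-trans (+-monoʳ-< m (toℕ<n j)) 2m≤N)

  P-inS : ∀ j → P false (inS j) ≡ toℕ j
  P-inS j = trans (cong toℕ (inverseʳ (pos false))) (toℕ-inject≤ j _)

  P-inB : ∀ j → P true (inB j) ≡ m + toℕ j
  P-inB j = trans (cong toℕ (inverseʳ (pos true))) (toℕ-fromℕ< _)

  inS-injective : Injective _≡_ _≡_ inS
  inS-injective {j} {j′} eq = toℕ-injective (trans (sym (P-inS j)) (trans (cong (P false) eq) (P-inS j′)))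

  inB-injective : Injective _≡_ _≡_ inB
  inB-injective {j} {j′} eq = toℕ-injective (+-cancelˡ-≡ m _ _
    (trans (sym (P-inB j)) (trans (cong (P true) eq) (P-inB j′))))

  class-inS : ∀ j → class false (inS j) ≡ S
  class-inS j = cls-S (≤-<-trans (≤-reflexive (P-inS j)) (toℕ<n j))

  class-inB : ∀ j → class true (inB j) ≡ B
  class-inB j = cls-B (≤-trans (m≤m+n m (toℕ j)) (≤-reflexive (sym (P-inB j))))
    (≤-<-trans (≤-reflexive (P-inB j)) (+-monoʳ-< m (toℕ<n j)))

  S⇒inS : ∀ s → class false s ≡ S → ∃[ j ] inS j ≡ s
  S⇒inS s eq = fromℕ< (cls-S⁻¹ eq) , P-inj false (trans (P-inS _) (toℕ-fromℕ< _))

  B⇒inB : ∀ s → class true s ≡ B → ∃[ j ] inB j ≡ s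
  B⇒inB s eq = fromℕ< j<m , P-inj true (trans (P-inB _) (trans (cong (m +_) (toℕ-fromℕ< j<m)) (m+[n∸m]≡n m≤p)))
    where
    m≤p = proj₁ (cls-B⁻¹ eq)
    j<m : P true s ∸ m < m
    j<m = +-cancelˡ-< m _ m (≤-<-trans (≤-reflexive (m+[n∸m]≡n m≤p)) (proj₂ (cls-B⁻¹ eq)))

  Matches : Permutation′ m → Set
  Matches π = ∀ j → (class true (inS j) ≡ B → class false (inB (π ⟨$⟩ʳ j)) ≡ S)
                  × (class false (inB (π ⟨$⟩ʳ j)) ≡ S → class true (inS j) ≡ B)

  -- The symbols common to `inS` and `inB` have to be matched among themselves. They have colour 2
  -- under `h` and colour 1 under `g`, the others the opposite colours, so avoiding equal colours
  -- achieves just this.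
  matching : ∃[ π ] Matches π
  matching = π , λ j → B⇒S (class true (inS j)) (class false (inB (π ⟨$⟩ʳ j))) (ok j)
                     , S⇒B (class true (inS j)) (class false (inB (π ⟨$⟩ʳ j))) (ok j)
    where
    colourB colourS : Cls → ℕ
    colourB B = 2
    colourB _ = 1
    colourS S = 1
    colourS _ = 2
    g h : Fin m → ℕ
    g j = colourS (class false (inB j))
    h j = colourB (class true (inS j))
    element : Fin m ⊎ Fin m → Fin N
    element (inj₁ j) = inB j
    element (inj₂ j) = inS j
    tooMany : (F : Fin (suc m) → Fin m ⊎ Fin m) → Injective _≡_ _≡_ (element ∘ F) →
      (φ : Fin N → ℕ) → (∀ {x y} → φ (element (F x)) ≡ φ (element (F y)) → element (F x) ≡ element (F y)) →
      (∀ x → φ (element (F x)) < m) → ⊥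
    tooMany F inj φ φ-inj φ<m = 1+n≰n (injective⇒≤ {f = λ x → fromℕ< (φ<m x)} λ {x} {y} eq →
      inj (φ-inj (trans (sym (toℕ-fromℕ< (φ<m x))) (trans (cong toℕ eq) (toℕ-fromℕ< (φ<m y))))))
    apart⇒injective : ∀ v → (∀ j j′ → g j ≡ v → h j′ ≡ v → inB j ≢ inS j′) →
      ∀ x y → [ g , h ]′ x ≡ v → [ g , h ]′ y ≡ v → element x ≡ element y → x ≡ y
    apart⇒injective v apart (inj₁ j) (inj₁ j′) _ _ eq = cong inj₁ (inB-injective eq)
    apart⇒injective v apart (inj₁ j) (inj₂ j′) c c′ eq = ⊥-elim (apart j j′ c c′ eq)
    apart⇒injective v apart (inj₂ j) (inj₁ j′) c c′ eq = ⊥-elim (apart j′ j c′ c (sym eq))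
    apart⇒injective v apart (inj₂ j) (inj₂ j′) _ _ eq = cong inj₂ (inS-injective eq)
    colourB≡1 : ∀ {a} → colourB a ≡ 1 → a ≢ B
    colourB≡1 () refl
    colourB≡2 : ∀ {a} → colourB a ≡ 2 → a ≡ B
    colourB≡2 {B} _ = refl
    colourB≡2 {S} ()
    colourB≡2 {X} ()
    colourS≡1 : ∀ {a} → colourS a ≡ 1 → a ≡ S
    colourS≡1 {S} _ = refl
    colourS≡1 {B} ()
    colourS≡1 {X} ()
    colourS≡2 : ∀ {a} → colourS a ≡ 2 → a ≢ S
    colourS≡2 () refl
    sparse : ∀ v → v ≢ 0 → AtMost m (λ x → [ g , h ]′ x ≡ v)
    sparse 0 v≢0 _ _ _ = v≢0 refl
    -- The elements of colour 1 are distinct symbols of left class `S`, those of colour 2 distinct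
    -- symbols of right class `B`; there are m of each class.
    sparse 1 _ F F-inj F-col = tooMany F
      (λ {x} {y} eq → F-inj (apart⇒injective 1 apart (F x) (F y) (F-col x) (F-col y) eq))
      (P false) (P-inj false) (λ x → small (F x) (F-col x))
      where
      apart : ∀ j j′ → g j ≡ 1 → h j′ ≡ 1 → inB j ≢ inS j′
      apart j j′ _ c eq = colourB≡1 c (trans (cong (class true) (sym eq)) (class-inB j))
      small : ∀ x → [ g , h ]′ x ≡ 1 → P false (element x) < m
      small (inj₁ j) c = cls-S⁻¹ (colourS≡1 c)
      small (inj₂ j) _ = cls-S⁻¹ (class-inS j)
    sparse 2 _ F F-inj F-col = tooMany F
      (λ {x} {y} eq → F-inj (apart⇒injective 2 apart (F x) (F y) (F-col x) (F-col y) eq))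
      (λ s → P true s ∸ m)
      (λ {x} {y} eq → P-inj true (∸-cancelʳ-≡ (proj₁ (cls-B⁻¹ (isB (F x) (F-col x)))) (proj₁ (cls-B⁻¹ (isB (F y) (F-col y)))) eq))
      (λ x → small (F x) (F-col x))
      where
      apart : ∀ j j′ → g j ≡ 2 → h j′ ≡ 2 → inB j ≢ inS j′
      apart j j′ c _ eq = colourS≡2 c (trans (cong (class false) eq) (class-inS j′))
      isB : ∀ x → [ g , h ]′ x ≡ 2 → class true (element x) ≡ B
      isB (inj₁ j) _ = class-inB j
      isB (inj₂ j) c = colourB≡2 c
      small : ∀ x → [ g , h ]′ x ≡ 2 → P true (element x) ∸ m < m
      small x c = +-cancelˡ-< m _ m (≤-<-trans (≤-reflexive (m+[n∸m]≡n (proj₁ (cls-B⁻¹ (isB x c))))) (proj₂ (cls-B⁻¹ (isB x c))))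
    sparse (suc (suc (suc v))) _ F _ F-col = none (F zero) (F-col zero)
      where
      noS : ∀ a → colourS a ≢ 3 + v
      noS S ()
      noS B ()
      noS X ()
      noB : ∀ a → colourB a ≢ 3 + v
      noB S ()
      noB B ()
      noB X ()
      none : ∀ x → [ g , h ]′ x ≢ 3 + v
      none (inj₁ j) = noS (class false (inB j))
      none (inj₂ j) = noB (class true (inS j))
    π = proj₁ (avoid g h sparse)
    ok = proj₂ (avoid g h sparse)
    B⇒S : ∀ a b → (colourB a ≡ colourS b → colourB a ≡ 0) → a ≡ B → b ≡ S
    B⇒S _ S _ _ = refl
    B⇒S B B k _ with k refl
    ... | ()
    B⇒S B X k _ with k refl
    ... | ()
    S⇒B : ∀ a b → (colourB a ≡ colourS b → colourB a ≡ 0) → b ≡ S → a ≡ B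
    S⇒B B _ _ _ = refl
    S⇒B S S k _ with k refl
    ... | ()
    S⇒B X S k _ with k refl
    ... | ()

  -- Once `B` corresponds to `S` and `X` to `X`, the remaining class `S` can only correspond to `B`.
  matches⇒swap : ∀ π → Matches π →
    (∀ j → class true (inS j) ≡ X → class false (inB (π ⟨$⟩ʳ j)) ≡ X) →
    (∀ j → class false (inB (π ⟨$⟩ʳ j)) ≡ X → class true (inS j) ≡ X) →
    ∀ j → class false (inB (π ⟨$⟩ʳ j)) ≡ swapCls (class true (inS j))
  matches⇒swap π matches X⇒ ⇒X j = cases _ _ (matches j) (X⇒ j) (⇒X j)
    where
    cases : ∀ a b → ((a ≡ B → b ≡ S) × (b ≡ S → a ≡ B)) → (a ≡ X → b ≡ X) → (b ≡ X → a ≡ X) → b ≡ swapCls a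
    cases S S (_ , k) _ _ with k refl
    ... | ()
    cases S B _ _ _ = refl
    cases S X _ _ k with k refl
    ... | ()
    cases B b (k , _) _ _ = k refl
    cases X b _ k _ = k refl

  module Involution (π : Permutation′ m) (match : ∀ j → class false (inB (π ⟨$⟩ʳ j)) ≡ swapCls (class true (inS j)))
    (xR : ∀ s → class true s ≡ X → class false s ≡ S) (xL : ∀ s → class false s ≡ X → class true s ≡ B) where

    -- The graph of `ψ`. As a relation it is visibly symmetric, so functionality alone makes `ψ` an
    -- involution.
    data Reflected (s t : Fin N) : Set where
      fixed : s ≡ t → class false s ≡ swapCls (class true s) → Reflected s t
      forth : ∀ j → class true (inS j) ≢ B → inS j ≡ s → inB (π ⟨$⟩ʳ j) ≡ t → Reflected s t
      back : ∀ j → class true (inS j) ≢ B → inB (π ⟨$⟩ʳ j) ≡ s → inS j ≡ t → Reflected s t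

    Reflected-sym : ∀ {s t} → Reflected s t → Reflected t s
    Reflected-sym (fixed refl c) = fixed refl c
    Reflected-sym (forth j c p q) = back j c q p
    Reflected-sym (back j c p q) = forth j c q p

    inS-notFixed : ∀ j → class true (inS j) ≢ B → class false (inS j) ≢ swapCls (class true (inS j))
    inS-notFixed j nB c = nB (trans (sym (swapCls-involutive _)) (cong swapCls (trans (sym c) (class-inS j))))

    inB-notFixed : ∀ j → class true (inS j) ≢ B →
      class false (inB (π ⟨$⟩ʳ j)) ≢ swapCls (class true (inB (π ⟨$⟩ʳ j)))
    inB-notFixed j nB c = nB (trans (sym (swapCls-involutive _))
      (cong swapCls (trans (sym (match j)) (trans c (cong swapCls (class-inB _))))))

    inS≢inB : ∀ j k → class true (inS j) ≢ B → inS j ≢ inB k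
    inS≢inB j k nB eq = nB (trans (cong (class true) eq) (class-inB k))

    Reflected-functional : ∀ {s t t′} → Reflected s t → Reflected s t′ → t ≡ t′
    Reflected-functional (fixed refl _) (fixed refl _) = refl
    Reflected-functional (fixed refl c) (forth j nB refl _) = ⊥-elim (inS-notFixed j nB c)
    Reflected-functional (fixed refl c) (back j nB refl _) = ⊥-elim (inB-notFixed j nB c)
    Reflected-functional (forth j nB refl _) (fixed _ c) = ⊥-elim (inS-notFixed j nB c)
    Reflected-functional (forth j _ refl refl) (forth j′ _ eq refl) =
      cong (λ x → inB (π ⟨$⟩ʳ x)) (inS-injective (sym eq))
    Reflected-functional (forth j nB refl _) (back j′ _ eq _) = ⊥-elim (inS≢inB j _ nB (sym eq))
    Reflected-functional (back j nB refl _) (fixed _ c) = ⊥-elim (inB-notFixed j nB c)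
    Reflected-functional (back j _ refl _) (forth j′ nB eq _) = ⊥-elim (inS≢inB j′ _ nB eq)
    Reflected-functional (back j _ refl refl) (back j′ _ eq refl) =
      cong inS (sym (perm-injective π (inB-injective eq)))

    Reflected-class : ∀ {s t} → Reflected s t → class false t ≡ swapCls (class true s)
    Reflected-class (fixed refl c) = c
    Reflected-class (forth j _ refl refl) = match j
    Reflected-class (back j _ refl refl) = trans (class-inS j) (cong swapCls (sym (class-inB _)))

    -- By (left, right) classes: (S, B) and (B, S) stay fixed, any other `S` on the left goes forth,
    -- any other `B` on the right goes back. The pairs (B, X) and (X, S), which fit nowhere, are
    -- excluded by `xR` and `xL`.
    reflected : ∀ s → ∃[ t ] Reflected s t
    reflected s = cases (class false s) (class true s) refl refl
      where
      goForth : class false s ≡ S → class true s ≢ B → ∃[ t ] Reflected s t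
      goForth isS notB = _ , forth j (notB ∘ trans (cong (class true) (sym j≡))) j≡ refl
        where
        j = proj₁ (S⇒inS s isS)
        j≡ = proj₂ (S⇒inS s isS)
      goBack : class true s ≡ B → class false s ≢ S → ∃[ t ] Reflected s t
      goBack isB notS = _ , back j (λ eq → notS (trans (cong (class false) (sym s≡)) (trans (match j) (cong swapCls eq)))) s≡ refl
        where
        k = proj₁ (B⇒inB s isB)
        j = π ⟨$⟩ˡ k
        s≡ : inB (π ⟨$⟩ʳ j) ≡ s
        s≡ = trans (cong inB (inverseʳ π)) (proj₂ (B⇒inB s isB))
      stay : class false s ≡ swapCls (class true s) → ∃[ t ] Reflected s t
      stay c = s , fixed refl c
      cases : ∀ a b → class false s ≡ a → class true s ≡ b → ∃[ t ] Reflected s t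
      cases S S p q = goForth p λ r → case (trans (sym q) r)
        where
        case : S ≢ B
        case ()
      cases S B p q = stay (trans p (cong swapCls (sym q)))
      cases S X p q = goForth p λ r → case (trans (sym q) r)
        where
        case : X ≢ B
        case ()
      cases B S p q = stay (trans p (cong swapCls (sym q)))
      cases B B p q = goBack q λ r → case (trans (sym p) r)
        where
        case : B ≢ S
        case ()
      cases B X p q with trans (sym p) (xR s q)
      ... | ()
      cases X b p q = goBack (xL s p) λ r → case (trans (sym p) r)
        where
        case : X ≢ S
        case ()

    ψ : Fin N → Fin N
    ψ s = proj₁ (reflected s)

    ψ-involutive : ∀ s → ψ (ψ s) ≡ s
    ψ-involutive s = Reflected-functional (proj₂ (reflected (ψ s))) (Reflected-sym (proj₂ (reflected s)))

    ψ-class : ∀ d s → class (not d) (ψ s) ≡ swapCls (class d s)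
    ψ-class true s = Reflected-class (proj₂ (reflected s))
    ψ-class false s = trans (sym (swapCls-involutive _))
      (cong swapCls (sym (Reflected-class (Reflected-sym (proj₂ (reflected s))))))

-- Assembling the array from its upper half.

flipIf-xor : ∀ {n} d e (c : Fin n) → flipIf d (flipIf e c) ≡ flipIf (d xor e) c
flipIf-xor false e c = refl
flipIf-xor true false c = refl
flipIf-xor true true c = opposite-involutive c

permutation-bijective : ∀ {n} (π : Permutation′ n) → Bijective _≡_ _≡_ (π ⟨$⟩ʳ_)
permutation-bijective π = perm-injective π , λ y → π ⟨$⟩ˡ y , λ { refl → inverseʳ π }

*<⇒<⌈/⌉ : ∀ c n i .{{_ : NonZero i}} → c * i < n → c < ⌈ n / i ⌉
*<⇒<⌈/⌉ c n i ci<n = begin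
  suc c               ≡⟨ m*n/n≡m (suc c) i ⟨
  suc c * i / i       ≤⟨ /-monoˡ-≤ i (∸-monoˡ-≤ 1 (begin
    suc (i + c * i)     ≡⟨ +-suc i (c * i) ⟨
    i + suc (c * i)     ≤⟨ +-monoʳ-≤ i ci<n ⟩
    i + n               ≡⟨ +-comm i n ⟩
    n + i               ∎)) ⟩
  (n + i ∸ 1) / i     ∎
  where open ≤-Reasoning

record UpperHalf (N m : ℕ) .{{_ : NonZero m}} : Set where
  field
    rows : ℕ → Permutation′ N
    pos : Bool → Permutation′ N
    covers : ∀ k → suc k ≤ m → ∀ d s →
      ∃[ r ] (r ≤ k × ∃[ c ] (toℕ c * suc k < N × rows r ⟨$⟩ʳ flipIf d c ≡ s))
    final : ∀ d s → ∃[ r ] (r < m × Running.Shows N (rows r) d s (toℕ (pos d ⟨$⟩ʳ s) / m))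

module Assembly {N m : ℕ} .{{m≢0 : NonZero m}} (half : UpperHalf N m) (2m≤N : m + m ≤ N) (N≤1+2m : N ≤ suc (m + m))
  (ψ : Fin N → Fin N) (ψ-involutive : ∀ s → ψ (ψ s) ≡ s)
  (ψ-class : ∀ d s → classAt m (UpperHalf.pos half) (not d) (ψ s) ≡ swapCls (classAt m (UpperHalf.pos half) d s))
  (middle : Permutation′ N)
  (middle-X : ∀ d s → classAt m (UpperHalf.pos half) d s ≡ X → Running.Shows N middle d s 0)
  where

  open UpperHalf half
  open Reflection {N} {m} 2m≤N pos using (P; class)

  reflect : Bool → Fin N → Fin N
  reflect false s = s
  reflect true s = ψ s

  reflect-involutive : ∀ v s → reflect v (reflect v s) ≡ s
  reflect-involutive false s = refl
  reflect-involutive true s = ψ-involutive s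

  row′ : (r : Fin N) → Dec (toℕ r < m) → Dec (toℕ (opposite r) < m) → Permutation′ N
  row′ r (yes _) _ = rows (toℕ r)
  -- The half turn: reverse the columns, read the mirrored upper row, then rename the symbols by
  -- `ψ`.
  row′ r (no _) (yes _) = reverse ∘ₚ rows (toℕ (opposite r)) ∘ₚ permutation ψ ψ ψ-involutive ψ-involutive
  row′ r (no _) (no _) = middle

  row : Fin N → Permutation′ N
  row r = row′ r (toℕ r <? m) (toℕ (opposite r) <? m)

  array : Array N
  array r c = row r ⟨$⟩ʳ c

  opposite-low : ∀ (r : Fin N) → toℕ r < m → m ≤ toℕ (opposite r)
  opposite-low r r<m = ≤-trans (m+n≤o⇒m≤o∸n m (≤-trans (+-monoʳ-≤ m r<m) 2m≤N)) (≤-reflexive (sym (opposite-prop r)))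

  array-outer : ∀ v r c → toℕ r < m → array (flipIf v r) c ≡ reflect v (rows (toℕ r) ⟨$⟩ʳ flipIf v c)
  array-outer false r c r<m = go (toℕ r <? m) (toℕ (opposite r) <? m)
    where
    go : ∀ a b → row′ r a b ⟨$⟩ʳ c ≡ rows (toℕ r) ⟨$⟩ʳ c
    go (yes _) _ = refl
    go (no r≮m) _ = ⊥-elim (r≮m r<m)
  array-outer true r c r<m = go (toℕ (opposite r) <? m) (toℕ (opposite (opposite r)) <? m)
    where
    go : ∀ a b → row′ (opposite r) a b ⟨$⟩ʳ c ≡ ψ (rows (toℕ r) ⟨$⟩ʳ opposite c)
    go (yes lt) _ = ⊥-elim (<⇒≱ lt (opposite-low r r<m))
    go (no _) (yes _) = cong (λ x → ψ (rows (toℕ x) ⟨$⟩ʳ opposite c)) (opposite-involutive r)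
    go (no _) (no ge) = ⊥-elim (ge (≤-<-trans (≤-reflexive (cong toℕ (opposite-involutive r))) r<m))

  opposite-middle : ∀ (r : Fin N) → toℕ r ≡ m → N ≡ suc (m + m) → toℕ (opposite r) ≡ m
  opposite-middle r r≡m N≡ = trans (opposite-prop r) (trans (cong₂ (λ a b → a ∸ suc b) N≡ r≡m) (m+n∸m≡n m m))

  array-middle : ∀ v r c → toℕ r ≡ m → N ≡ suc (m + m) → array (flipIf v r) c ≡ middle ⟨$⟩ʳ c
  array-middle v r c r≡m N≡ = go (flipIf v r) (at v) (at′ v) (_ <? m) (_ <? m)
    where
    at : ∀ v → toℕ (flipIf v r) ≡ m
    at false = r≡m
    at true = opposite-middle r r≡m N≡
    at′ : ∀ v → toℕ (opposite (flipIf v r)) ≡ m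
    at′ false = opposite-middle r r≡m N≡
    at′ true = trans (cong toℕ (opposite-involutive r)) r≡m
    go : (r : Fin N) → toℕ r ≡ m → toℕ (opposite r) ≡ m → ∀ a b → row′ r a b ⟨$⟩ʳ c ≡ middle ⟨$⟩ʳ c
    go r e _ (yes lt) _ = ⊥-elim (<-irrefl e lt)
    go r _ e′ (no _) (yes lt) = ⊥-elim (<-irrefl e′ lt)
    go r _ _ (no _) (no _) = refl

  m≤N : m ≤ N
  m≤N = ≤-trans (m≤m+n m m) 2m≤N

  Occurs : Bool → Bool → Fin N → (Fin N → Fin N → Set) → Set
  Occurs v d s Where = ∃[ r ] ∃[ c ] (Where r c × array (flipIf v r) (flipIf d c) ≡ s)

  -- The half turn takes a lower corner to the upper corner of the opposite side, hence `v xor d`,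
  -- while `reflect v` renames the symbol.
  outer : ∀ v d s r → r < m → ∀ c → rows r ⟨$⟩ʳ flipIf (v xor d) c ≡ reflect v s →
    ∃[ r′ ] (toℕ r′ ≡ r × array (flipIf v r′) (flipIf d c) ≡ s)
  outer v d s r r<m c eq = r′ , toℕ-fromℕ< (<-≤-trans r<m m≤N) , (begin
    array (flipIf v r′) (flipIf d c)                         ≡⟨ array-outer v r′ (flipIf d c) (≤-<-trans (≤-reflexive r′≡) r<m) ⟩
    reflect v (rows (toℕ r′) ⟨$⟩ʳ flipIf v (flipIf d c))     ≡⟨ cong₂ (λ x y → reflect v (rows x ⟨$⟩ʳ y)) r′≡ (flipIf-xor v d c) ⟩
    reflect v (rows r ⟨$⟩ʳ flipIf (v xor d) c)               ≡⟨ cong (reflect v) eq ⟩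
    reflect v (reflect v s)                                  ≡⟨ reflect-involutive v s ⟩
    s                                                        ∎)
    where
    open ≡-Reasoning
    r′ = fromℕ< (<-≤-trans r<m m≤N)
    r′≡ = toℕ-fromℕ< (<-≤-trans r<m m≤N)

  inMiddle : ∀ v d s → class d s ≡ X → Occurs v d s (λ r c → toℕ r ≡ m × toℕ c ≡ 0)
  inMiddle v d s isX with middle-X d s isX
  ... | c , c≡0 , eq = r , c , (r≡m , c≡0) , trans (array-middle v r (flipIf d c) r≡m N≡) eq
    where
    N≡ : N ≡ suc (m + m)
    N≡ = ≤-antisym N≤1+2m (≤-<-trans (cls-X⁻¹ isX) (toℕ<n (pos d ⟨$⟩ʳ s)))
    m<N : m < N
    m<N = ≤-trans (s≤s (m≤m+n m m)) (≤-reflexive (sym N≡))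
    r = fromℕ< m<N
    r≡m = toℕ-fromℕ< m<N

  covers-thin : ∀ v d k → suc k ≤ m → ∀ s → Occurs v d s (λ r c → toℕ r < suc k × toℕ c * suc k < N)
  covers-thin v d k k<m s with covers k k<m (v xor d) (reflect v s)
  ... | r , r≤k , c , small , eq with outer v d s r (≤-<-trans r≤k k<m) c eq
  ... | r′ , r′≡ , eq′ = r′ , c , (s≤s (≤-trans (≤-reflexive r′≡) r≤k) , small) , eq′

  -- A symbol missing from the first two columns of its half has class `X` there. As `swapCls` fixes
  -- `X`, it has class `X` on side `d` too and stands at that end of the middle row.
  covers-two : ∀ v d s → Occurs v d s (λ r c → toℕ r ≤ m × toℕ c < 2)
  covers-two v d s = cases (P (v xor d) (reflect v s) <? m + m)
    where
    isX : ∀ v → class (v xor d) (reflect v s) ≡ X → class d s ≡ X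
    isX false eq = eq
    isX true eq = trans (sym (swapCls-involutive _)) (cong swapCls (trans (sym (ψ-class d s)) eq))
    cases : Dec (P (v xor d) (reflect v s) < m + m) → Occurs v d s (λ r c → toℕ r ≤ m × toℕ c < 2)
    cases (yes low) with final (v xor d) (reflect v s)
    ... | r , r<m , c , c≡ , eq with outer v d s r r<m c eq
    ... | r′ , r′≡ , eq′ = r′ , c , (≤-trans (≤-reflexive r′≡) (<⇒≤ r<m) ,
      ≤-<-trans (≤-reflexive c≡) (m<n*o⇒m/o<n (<-≤-trans low (≤-reflexive (cong (m +_) (sym (+-identityʳ m))))))) , eq′
    cases (no high) with inMiddle v d s (isX v (cls-X (≮⇒≥ high)))
    ... | r , c , (r≡ , c≡) , eq = r , c , (≤-reflexive r≡ , s≤s (≤-trans (≤-reflexive c≡) z≤n)) , eq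

  -- Class `S` is found in the upper half. Class `B` is found in the lower half, since `ψ` turns it
  -- into `S` on the other side. Class `X` is found in the middle row.
  covers-one : ∀ v d s → Occurs v d s (λ r c → toℕ c ≡ 0)
  covers-one v d s = cases (class d s) refl
    where
    sided : ∀ w → class (w xor d) (reflect w s) ≡ S → Occurs v d s (λ r c → toℕ c ≡ 0)
    sided w isS with final (w xor d) (reflect w s)
    ... | r , r<m , c , c≡ , eq with outer w d s r r<m c eq
    ... | r′ , _ , eq′ = flipIf v (flipIf w r′) , c , trans c≡ (m<n⇒m/n≡0 (cls-S⁻¹ isS)) ,
      trans (cong (λ x → array x (flipIf d c)) (flipIf-involutive v (flipIf w r′))) eq′
    cases : ∀ a → class d s ≡ a → Occurs v d s (λ r c → toℕ c ≡ 0)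
    cases S eq = sided false eq
    cases B eq = sided true (trans (ψ-class d s) (cong swapCls eq))
    cases X eq with inMiddle v d s eq
    ... | r , c , (_ , c≡) , eq′ = r , c , c≡ , eq′

  -- Three ranges of heights i: up to m the upper half suffices; for m < i < N the rectangle has at
  -- least two columns; for i = N one full column is enough.
  corner-covers : ∀ v d → UpperLeftCovers (λ r c → array (flipIf v r) (flipIf d c))
  corner-covers v d zero {{i≢0}} _ = ⊥-elim (≢-nonZero⁻¹ 0 {{i≢0}} refl)
  corner-covers v d (suc k) k<N s with suc k ≤? m | m≤n⇒m<n∨m≡n k<N
  ... | yes k<m | _ with covers-thin v d k k<m s
  ...   | r , c , (r≤k , small) , eq = r , c , r≤k , *<⇒<⌈/⌉ (toℕ c) N (suc k) small , eq
  corner-covers v d (suc k) k<N s | no k≮m | inj₁ i<N with covers-two v d s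
  ...   | r , c , (r≤m , c<2) , eq = r , c , ≤-<-trans r≤m (≰⇒> k≮m) ,
    *<⇒<⌈/⌉ (toℕ c) N (suc k) (≤-<-trans (≤-trans (*-monoˡ-≤ (suc k) (s≤s⁻¹ c<2)) (≤-reflexive (*-identityˡ (suc k)))) i<N) , eq
  corner-covers v d (suc k) k<N s | no k≮m | inj₂ refl with covers-one v d s
  ...   | r , c , c≡0 , eq = r , c , toℕ<n r ,
    *<⇒<⌈/⌉ (toℕ c) N (suc k) (≤-<-trans (≤-reflexive (cong (_* suc k) c≡0)) z<s) , eq

  array-RPA : RPA-type1234 array
  array-RPA = (perms , corner-covers false false) , (perms , corner-covers false true)
            , (perms , corner-covers true false) , (perms , corner-covers true true)
    where
    perms : RowsArePermutations array
    perms r = permutation-bijective (row r)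

opposite-sum : ∀ {n} (s : Fin n) → suc (toℕ s + toℕ (opposite s)) ≡ n
opposite-sum {n} s = trans (cong (λ x → suc (toℕ s + x)) (opposite-prop s)) (m+[n∸m]≡n (toℕ<n s))

-- From an initial state to an upper half.

module Start (N : ℕ) where
  open Process N
  open Running N

  -- The cell is kept from level to level, and its place is largest at the last level, where it is
  -- still below N.
  τ-cell : ∀ f i {r} c → r ≤ i → r + c * suc (i + f) < N → τ i f (r + c * suc i) ≡ 0
  τ-cell zero i c _ _ = refl
  τ-cell (suc f) i {r} c r≤i small = trans (τ-low i f _ low) (trans (cong (τ (suc i) f) (shift-cell i c r≤i))
    (τ-cell f (suc i) c (m≤n⇒m≤1+n r≤i) small′))
    where
    small′ : r + c * suc (suc i + f) < N
    small′ = ≤-<-trans (≤-reflexive (cong (λ x → r + c * suc x) (sym (+-suc i f)))) small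
    low : shift i (r + c * suc i) < N
    low = ≤-<-trans (≤-trans (≤-reflexive (shift-cell i c r≤i)) (+-monoʳ-≤ r (*-monoʳ-≤ c (s≤s (s≤s (m≤m+n i f)))))) small′

  top≢low : ∀ i f p p′ → N ≤ shift i p → shift i p′ < N → τ i (suc f) p ≢ τ i (suc f) p′
  top≢low i f p p′ top low eq = 1+n≰n (≤-trans
    (≤-reflexive (trans (sym (τ-top i f p top)) (trans eq (τ-low i f p′ low)))) (τ≤fuel (suc i) f _))

  shift-zero : ∀ p → shift 0 p ≡ p + p
  shift-zero p = cong (p +_) (n/1≡n p)

  -- Taking `k₀` = 1 allows level 0 positions that disagree with row 0; height 1 needs no positions,
  -- because the rectangle is then the entire row.
  upperHalf : ∀ M k₀ → k₀ ≤ 1 → k₀ ≤ M → (rows : ℕ → Permutation′ N) (poss : ℕ → Bool → Permutation′ N) →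
    (∀ s → rows 0 ⟨$⟩ʳ s ≡ s) →
    (∀ k → k₀ ≤ k → k ≤ M → ∀ d s → ∃[ r ] (r ≤ k × Shows (rows r) d s (toℕ (poss k d ⟨$⟩ʳ s) / suc k))) →
    UpperHalf N (suc M)
  upperHalf M k₀ k₀≤1 k₀≤M rows poss rows₀ shown = record
    { rows = rows
    ; pos = poss M
    ; covers = λ k k<m d s → covers k (s≤s⁻¹ k<m) d s (k₀ ≤? k)
    ; final = λ d s → let r , r≤M , shows = shown M k₀≤M ≤-refl d s in r , s≤s r≤M , shows }
    where
    covers : ∀ k → k ≤ M → ∀ d s → Dec (k₀ ≤ k) →
      ∃[ r ] (r ≤ k × ∃[ c ] (toℕ c * suc k < N × rows r ⟨$⟩ʳ flipIf d c ≡ s))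
    covers k k≤M d s (yes k₀≤k) = let r , r≤k , c , c≡ , eq = shown k k₀≤k k≤M d s in
      r , r≤k , c , ≤-<-trans (≤-trans (≤-reflexive (cong (_* suc k) c≡)) (m/n*n≤m (toℕ (poss k d ⟨$⟩ʳ s)) (suc k))) (toℕ<n (poss k d ⟨$⟩ʳ s)) , eq
    covers zero _ d s (no _) = 0 , z≤n , flipIf d s
      , ≤-<-trans (≤-reflexive (*-identityʳ _)) (toℕ<n (flipIf d s))
      , trans (rows₀ _) (flipIf-involutive d s)
    covers (suc k) _ d s (no k₀≰k) = ⊥-elim (k₀≰k (≤-trans k₀≤1 (s≤s z≤n)))

-- Even orders.

module Even (M : ℕ) where
  m N : ℕ
  m = suc M
  N = m + m
  open Process N
  open Running N
  open Start N

  -- The left and the right position add up to 2m - 1, so exactly one of them is at least m and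
  -- overflows at once.
  initial : State 0 M
  initial = record { pos = pos ; noClash = noClash M }
    where
    pos : Bool → Permutation′ N
    pos false = idₚ
    pos true = reverse
    sum : ∀ d s → suc (toℕ (pos d ⟨$⟩ʳ s) + toℕ (pos (not d) ⟨$⟩ʳ s)) ≡ N
    sum false s = opposite-sum s
    sum true s = trans (cong suc (+-comm (toℕ (opposite s)) (toℕ s))) (opposite-sum s)
    high⇒ : ∀ {p} → m ≤ p → N ≤ shift 0 p
    high⇒ {p} m≤p = ≤-trans (+-mono-≤ m≤p m≤p) (≤-reflexive (sym (shift-zero p)))
    low⇒ : ∀ {p} → p < m → shift 0 p < N
    low⇒ {p} p<m = ≤-<-trans (≤-reflexive (shift-zero p)) (+-mono-< p<m p<m)
    noClash : ∀ f d s → τ 0 f (toℕ (pos d ⟨$⟩ʳ s)) ≡ τ 0 f (toℕ (pos (not d) ⟨$⟩ʳ s)) → τ 0 f (toℕ (pos d ⟨$⟩ʳ s)) ≡ 0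
    noClash zero d s _ = refl
    noClash (suc f) d s eq with m ≤? toℕ (pos d ⟨$⟩ʳ s) | m ≤? toℕ (pos (not d) ⟨$⟩ʳ s)
    ... | yes a | yes b = ⊥-elim (1+n≰n (≤-trans (s≤s (+-mono-≤ a b)) (≤-reflexive (sum d s))))
    ... | yes a | no b = ⊥-elim (top≢low 0 f (toℕ (pos d ⟨$⟩ʳ s)) (toℕ (pos (not d) ⟨$⟩ʳ s)) (high⇒ a) (low⇒ (≰⇒> b)) eq)
    ... | no a | yes b = ⊥-elim (top≢low 0 f (toℕ (pos (not d) ⟨$⟩ʳ s)) (toℕ (pos d ⟨$⟩ʳ s)) (high⇒ b) (low⇒ (≰⇒> a)) (sym eq))
    ... | no a | no b = ⊥-elim (<-irrefl (sum d s) (≤-trans (≤-reflexive (sym (cong suc (+-suc _ _)))) (+-mono-≤ (≰⇒> a) (≰⇒> b))))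

  R : Run M initial
  R = run M 0 M refl initial

  half : UpperHalf N m
  half = upperHalf M 0 z≤n z≤n (update 0 idₚ (Run.rows R)) (Run.poss R)
    (λ s → cong (_⟨$⟩ʳ s) (update-here 0 idₚ (Run.rows R))) shown
    where
    rows = update 0 idₚ (Run.rows R)
    shown : ∀ k → 0 ≤ k → k ≤ M → ∀ d s → ∃[ r ] (r ≤ k × Shows (rows r) d s (toℕ (Run.poss R k d ⟨$⟩ʳ s) / suc k))
    shown k _ k≤M d s with Run.covers R k z≤n k≤M d s
    ... | inj₁ (r , 0<r , r≤k , shows) = r , r≤k ,
      subst (λ ρ → Shows ρ d s _) (sym (update-there _ (Run.rows R) (>⇒≢ 0<r))) shows
    ... | inj₂ col = 0 , z≤n , State.pos initial d ⟨$⟩ʳ s , trans (sym (n/1≡n _)) (sym col) ,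
      trans (cong (_⟨$⟩ʳ flipIf d (State.pos initial d ⟨$⟩ʳ s)) (update-here 0 idₚ (Run.rows R))) (back d)
      where
      back : ∀ d → flipIf d (State.pos initial d ⟨$⟩ʳ s) ≡ s
      back false = refl
      back true = opposite-involutive s

  open UpperHalf half using (pos)
  open Reflection {N} {m} ≤-refl pos

  noX : ∀ d s → class d s ≢ X
  noX d s eq = <⇒≱ (toℕ<n (pos d ⟨$⟩ʳ s)) (cls-X⁻¹ eq)

  π = proj₁ matching

  match : ∀ j → class false (inB (π ⟨$⟩ʳ j)) ≡ swapCls (class true (inS j))
  match = matches⇒swap π (proj₂ matching) (λ j eq → ⊥-elim (noX true _ eq)) (λ j eq → ⊥-elim (noX false _ eq))

  open Involution π match (λ s eq → ⊥-elim (noX true s eq)) (λ s eq → ⊥-elim (noX false s eq))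

  rpa : ∃[ A ] RPA-type1234 {N} A
  rpa = array , array-RPA
    where open Assembly half ≤-refl (n≤1+n N) ψ ψ-involutive ψ-class
            idₚ (λ d s eq → ⊥-elim (noX d s eq))

-- Odd orders from 7 on.

module Odd (w : ℕ) where
  m M f N : ℕ
  m = 3 + w
  M = 2 + w
  f = suc w
  N = suc (m + m)
  open Process N
  open Running N
  open Start N

  m<N : m < N
  m<N = s≤s (m≤m+n m m)

  u v : Fin N
  u = fromℕ< m<N
  v = fromℕ< (n<1+n (m + m))

  toℕ-u : toℕ u ≡ m
  toℕ-u = toℕ-fromℕ< m<N

  toℕ-v : toℕ v ≡ m + m
  toℕ-v = toℕ-fromℕ< (n<1+n (m + m))

  -- On the left, u and v trade places: v will reach the middle column in row 1,
  -- so that u is free to move there.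
  pos₀ : Bool → Permutation′ N
  pos₀ false = transpose u v
  pos₀ true = reverse

  P₀ : Bool → Fin N → ℕ
  P₀ d s = toℕ (pos₀ d ⟨$⟩ʳ s)

  opposite≡ : ∀ (s : Fin N) {a b} → toℕ s ≡ a → a + b ≡ m + m → toℕ (opposite s) ≡ b
  opposite≡ s {a} {b} refl eq = +-cancelˡ-≡ a _ _ (trans (cong pred (opposite-sum s)) (sym eq))

  Pu-left : P₀ false u ≡ m + m
  Pu-left = trans (cong toℕ (transpose-left u v)) toℕ-v

  Pu-right : P₀ true u ≡ m
  Pu-right = opposite≡ u toℕ-u refl

  Pv-left : P₀ false v ≡ m
  Pv-left = trans (cong toℕ (transpose-right u v)) toℕ-u

  Pv-right : P₀ true v ≡ 0
  Pv-right = opposite≡ v toℕ-v (+-identityʳ (m + m))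

  P-left : ∀ {s} → s ≢ u → s ≢ v → P₀ false s ≡ toℕ s
  P-left s≢u s≢v = cong toℕ (transpose-other s≢u s≢v)

  high⇒ : ∀ {p} → m < p → N ≤ shift 0 p
  high⇒ {p} m<p = ≤-trans (≤-trans (n≤1+n N) (≤-trans (≤-reflexive (cong suc (sym (+-suc m m)))) (+-mono-≤ m<p m<p)))
    (≤-reflexive (sym (shift-zero p)))

  low⇒ : ∀ {p} → p ≤ m → shift 0 p < N
  low⇒ {p} p≤m = s≤s (≤-trans (≤-reflexive (shift-zero p)) (+-mono-≤ p≤m p≤m))

  sum₀ : ∀ {s} → s ≢ u → s ≢ v → P₀ false s + P₀ true s ≡ m + m
  sum₀ {s} s≢u s≢v = trans (cong (_+ P₀ true s) (P-left s≢u s≢v)) (cong pred (opposite-sum s))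

  -- `u` overflows on the left only, and `v` never moves on the right. For any other symbol the two
  -- positions add up to 2m and neither is m, so exactly one overflows.
  noClash-left : ∀ s → τ 0 M (P₀ false s) ≡ τ 0 M (P₀ true s) → τ 0 M (P₀ false s) ≡ 0
  noClash-left s eq = cases (s ≟ᶠ u) (s ≟ᶠ v)
    where
    left right : ℕ
    left = P₀ false s
    right = P₀ true s
    cases : Dec (s ≡ u) → Dec (s ≡ v) → τ 0 M left ≡ 0
    cases (yes refl) _ = ⊥-elim (top≢low 0 f left right
      (high⇒ (≤-trans (s≤s (m≤n+m m (2 + w))) (≤-reflexive (sym Pu-left)))) (low⇒ (≤-reflexive Pu-right)) eq)
    cases (no _) (yes refl) = trans eq (trans (cong (τ 0 M) Pv-right) (τ-cell M 0 0 z≤n z<s))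
    cases (no s≢u) (no s≢v) with left ≤? m
    ... | no high = ⊥-elim (top≢low 0 f left right (high⇒ (≰⇒> high))
      (low⇒ (≮⇒≥ λ m<r → <-irrefl (sym (sum₀ s≢u s≢v)) (+-mono-<-≤ (≰⇒> high) (<⇒≤ m<r)))) eq)
    ... | yes low = ⊥-elim (top≢low 0 f right left (high⇒ (≰⇒> λ r≤m → <-irrefl (sum₀ s≢u s≢v) (+-mono-<-≤ (≤∧≢⇒< low left≢m) r≤m)))
      (low⇒ low) (sym eq))
      where
      left≢m : left ≢ m
      left≢m eq = s≢u (toℕ-injective (trans (sym (P-left s≢u s≢v)) (trans eq (sym toℕ-u))))

  initial : State 0 M
  initial = record { pos = pos₀ ; noClash = noClash }
    where
    noClash : ∀ d s → τ 0 M (P₀ d s) ≡ τ 0 M (P₀ (not d) s) → τ 0 M (P₀ d s) ≡ 0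
    noClash false s eq = noClash-left s eq
    noClash true s eq = trans eq (noClash-left s (sym eq))

  2m≤ : 2 * m ≤ N
  2m≤ = ≤-trans (≤-reflexive (cong (m +_) (+-identityʳ m))) (n≤1+n (m + m))

  <2m : N < 2 * suc m
  <2m = s≤s (≤-reflexive (sym (trans (cong (m +_) (+-identityʳ (suc m))) (+-suc m m))))

  open Step {0} {f} initial m 2m≤ <2m

  -- The index of position 2m - 2, whose symbol has position 2 on the other side. It overflows in
  -- the first step because m ≥ 3.
  a : Fin m
  a = fromℕ< {w} (m≤n+m (suc w) 2)

  P-top : ∀ d → P₀ d (topSym d a) ≡ suc m + w
  P-top d = trans (P-topSym d a) (cong₂ _+_ (trans (cong (_∸ m) (sym (+-suc m m))) (m+n∸m≡n m (suc m))) (toℕ-fromℕ< _))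

  other₂ : ∀ d → P₀ (not d) (topSym d a) ≡ 2
  other₂ d = cases d (topSym d a ≟ᶠ u) (topSym d a ≟ᶠ v) (P-top d)
    where
    ring : suc m + w + 2 ≡ m + m
    ring = eq w
      where
      eq : ∀ w → suc (3 + w) + w + 2 ≡ 3 + w + (3 + w)
      eq = solve-∀
    ≢m+m : suc m + w ≢ m + m
    ≢m+m eq = m+1+n≢m (suc m + w) {1} (trans ring (sym eq))
    ≢m : suc m + w ≢ m
    ≢m eq = m+1+n≢m m {w} (trans (+-suc m w) eq)
    cases : ∀ d {s} → Dec (s ≡ u) → Dec (s ≡ v) → P₀ d s ≡ suc m + w → P₀ (not d) s ≡ 2
    cases false (yes refl) _ eq = ⊥-elim (≢m+m (trans (sym eq) Pu-left))
    cases true (yes refl) _ eq = ⊥-elim (≢m (trans (sym eq) Pu-right))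
    cases false (no _) (yes refl) eq = ⊥-elim (≢m (trans (sym eq) Pv-left))
    cases true (no _) (yes refl) eq with trans (sym eq) Pv-right
    ... | ()
    cases false {s} (no s≢u) (no s≢v) eq = +-cancelˡ-≡ (suc m + w) _ _
      (trans (cong (_+ P₀ true s) (sym eq)) (trans (sum₀ s≢u s≢v) (sym ring)))
    cases true {s} (no s≢u) (no s≢v) eq = +-cancelʳ-≡ (suc m + w) _ _
      (trans (cong (P₀ false s +_) (sym eq)) (trans (sum₀ s≢u s≢v) (trans (sym ring) (+-comm (suc m + w) 2))))

  -- far d, the symbol that is still in the third column of side d after m rows, is put in
  -- the outermost column of the other side for one d and in the next column for the other:
  -- only then can an involution ψ with the required effect on the classes exchange the two.
  target : Bool → Fin m
  target false = zero
  target true = suc zero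

  2m<N : 2 * m < N
  2m<N = s≤s (≤-reflexive (cong (m +_) (+-identityʳ m)))

  -- Position 2 ends at 2m < N and never moves, so this symbol may take any slot.
  symColour-a : ∀ d → symColour d a ≡ 0
  symColour-a d = trans (cong (λ p → τ 1 f (shift 0 p)) (other₂ d)) (τ-cell f 1 2 z≤n 2m<N)

  avoided : ∀ d → ∃[ π ] (π ⟨$⟩ʳ a ≡ target d × (∀ j → j ≢ a → Avoids slotColour (symColour d) π j))
  -- With one slot prescribed, m - 1 indices remain; ⌊N/3⌋ ≤ m - 1 provides the bound.
  avoided d = avoidAt a (target d) slotColour (symColour d) (colours-sparse d (2 + w) N<3m)
    where
    N<3m : N < 3 * (3 + w)
    N<3m = ≤-trans (m≤m+n (suc N) (suc w)) (≤-reflexive (ring w))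
      where
      ring : ∀ w → suc (suc (3 + w + (3 + w))) + suc w ≡ 3 * (3 + w)
      ring = solve-∀

  π₁ : Bool → Permutation′ m
  π₁ d = proj₁ (avoided d)

  good : ∀ d j → Avoids slotColour (symColour d) (π₁ d) j
  good d j = cases (j ≟ᶠ a)
    where
    cases : Dec (j ≡ a) → Avoids slotColour (symColour d) (π₁ d) j
    cases (yes refl) _ = symColour-a d
    cases (no j≢a) = proj₂ (proj₂ (avoided d)) j j≢a

  open Move π₁ good

  R₁ : Run M next
  R₁ = run f 1 M refl next

  abstract
    R₀ : Run M initial
    R₀ = stepRun {M} {0} {f} initial m 2m≤ <2m π₁ good (s≤s z≤n) R₁

    rows-R₀ : Run.rows R₀ 1 ≡ row
    rows-R₀ = update-here 1 row (Run.rows R₁)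

    poss-R₀ : Run.poss R₀ M ≡ Run.poss R₁ M
    poss-R₀ = update-there {k = 0} {M} pos₀ (Run.poss R₁) λ ()

  -- `v` moves on neither side in row 1, so the outer m columns on both sides are closed to it.
  row-v : Shows row false v m
  row-v = c , ≤-antisym c≤m (inner false) , inverseʳ row
    where
    c = row ⟨$⟩ˡ v
    low : ∀ d → shift 0 (P₀ d v) < N
    low false = low⇒ (≤-reflexive Pv-left)
    low true = low⇒ (≤-trans (≤-reflexive Pv-right) z≤n)
    inner : ∀ d → m ≤ toℕ (flipIf d c)
    inner = low⇒inner v low
    c≤m : toℕ c ≤ m
    c≤m = +-cancelʳ-≤ m _ _ (≤-trans (+-monoʳ-≤ (toℕ c) (inner true)) (≤-reflexive (cong pred (opposite-sum c))))

  half : UpperHalf N m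
  half = upperHalf M 1 ≤-refl (s≤s z≤n) rows (Run.poss R₀)
    (λ s → cong (_⟨$⟩ʳ s) (update-here 0 idₚ (Run.rows R₀))) shown
    where
    rows = update 0 idₚ (Run.rows R₀)
    later : ∀ {r} d s {c} → 0 < r → Shows (Run.rows R₀ r) d s c → Shows (rows r) d s c
    later d s {c} 0<r = subst (λ ρ → Shows ρ d s c) (sym (update-there _ (Run.rows R₀) (>⇒≢ 0<r)))
    first : ∀ d s → flipIf d (pos₀ d ⟨$⟩ʳ s) ≡ s → Shows (rows 0) d s (P₀ d s)
    first d s eq = pos₀ d ⟨$⟩ʳ s , refl , trans (cong (_⟨$⟩ʳ flipIf d (pos₀ d ⟨$⟩ʳ s)) (update-here 0 idₚ (Run.rows R₀))) eq
    shown : ∀ k → 1 ≤ k → k ≤ M → ∀ d s → ∃[ r ] (r ≤ k × Shows (rows r) d s (toℕ (Run.poss R₀ k d ⟨$⟩ʳ s) / suc k))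
    shown k 1≤k k≤M d s = [ (λ (r , 0<r , r≤k , shows) → r , r≤k , later d s 0<r shows)
      , (λ col → unmoved d (s ≟ᶠ u) (s ≟ᶠ v) (trans col (n/1≡n (P₀ d s)))) ]′ (Run.covers R₀ k z≤n k≤M d s)
      where
      unmoved : ∀ d → Dec (s ≡ u) → Dec (s ≡ v) → toℕ (Run.poss R₀ k d ⟨$⟩ʳ s) / suc k ≡ P₀ d s →
        ∃[ r ] (r ≤ k × Shows (rows r) d s (toℕ (Run.poss R₀ k d ⟨$⟩ʳ s) / suc k))
      unmoved true _ _ col = 0 , z≤n , subst (Shows (rows 0) true s) (sym col) (first true s (opposite-involutive s))
      -- If `u` were not shown again, it would still be assigned to column 2m at a level k ≥ 1,
      -- where that column lies beyond position N.
      unmoved false (yes refl) _ col = ⊥-elim (<⇒≱ (toℕ<n (Run.poss R₀ k false ⟨$⟩ʳ s)) (begin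
        N                                       ≤⟨ s≤s (m≤m+n (m + m) _) ⟩
        suc (m + m) + pred (m + m)              ≡⟨ +-suc (m + m) (pred (m + m)) ⟨
        (m + m) + (m + m)                       ≡⟨ ring (m + m) ⟩
        (m + m) * 2                             ≤⟨ *-monoʳ-≤ (m + m) (s≤s 1≤k) ⟩
        (m + m) * suc k                         ≡⟨ cong (_* suc k) (trans col Pu-left) ⟨
        toℕ (Run.poss R₀ k false ⟨$⟩ʳ s) / suc k * suc k ≤⟨ m/n*n≤m _ (suc k) ⟩
        toℕ (Run.poss R₀ k false ⟨$⟩ʳ s)        ∎))
        where
        open ≤-Reasoning
        ring : ∀ x → x + x ≡ x * 2
        ring = solve-∀
      unmoved false (no _) (yes refl) col = 1 , 1≤k , later false s z<s
        (subst₂ (λ ρ c → Shows ρ false s c) (sym rows-R₀) (sym (trans col Pv-left)) row-v)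
      unmoved false (no s≢u) (no s≢v) col =
        0 , z≤n , subst (Shows (rows 0) false s) (sym col) (first false s (transpose-other s≢u s≢v))

  2m≤N : m + m ≤ N
  2m≤N = n≤1+n (m + m)

  open UpperHalf half using (pos)
  open Reflection {N} {m} 2m≤N pos

  -- This symbol starts at position 2 on side `d`, keeps residue 0 in column 2, and so ends at 2m,
  -- the only position of class `X`.
  far : Bool → Fin N
  far d = topSym (not d) a

  P-far : ∀ d → P d (far d) ≡ m + m
  P-far d = trans (Run.keep R₀ d (far d) 0 2 z≤n (start d) 2m<N) (cong (m +_) (+-identityʳ m))
    where
    start : ∀ d → P₀ d (far d) ≡ 2
    start false = other₂ true
    start true = other₂ false

  P-near : ∀ d → 1 + toℕ (target d) * m < N → P d (topSym d a) ≡ 1 + toℕ (target d) * m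
  P-near d small = trans (cong (λ ρ → toℕ (ρ d ⟨$⟩ʳ topSym d a)) poss-R₀)
    (Run.keep R₁ d (topSym d a) 1 (toℕ (target d)) ≤-refl
      (trans (topSym-newPos d (topSym d a) a refl) (cong slot (proj₁ (proj₂ (avoided d))))) small)

  P-right-left : P false (far true) ≡ 1
  P-right-left = P-near false (s≤s z<s)

  P-left-right : P true (far false) ≡ m + 1
  P-left-right = trans (P-near true small) (trans (cong suc (+-identityʳ m)) (+-comm 1 m))
    where
    small : 1 + (m + 0) < N
    small = s≤s (≤-trans (≤-reflexive (cong suc (+-identityʳ m))) (+-monoˡ-≤ m {1} {m} (s≤s z≤n)))

  class-far : ∀ d → class d (far d) ≡ X
  class-far d = cls-X (≤-reflexive (sym (P-far d)))

  class-right-left : class false (far true) ≡ S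
  class-right-left = cls-S (≤-<-trans (≤-reflexive P-right-left) (s≤s z<s))

  class-left-right : class true (far false) ≡ B
  class-left-right = cls-B (≤-trans (m≤m+n m 1) (≤-reflexive (sym P-left-right)))
    (≤-<-trans (≤-reflexive P-left-right) (+-monoʳ-< m (s≤s z<s)))

  X⇒far : ∀ d s → class d s ≡ X → s ≡ far d
  X⇒far d s isX = P-inj d (trans (≤-antisym (s≤s⁻¹ (toℕ<n (pos d ⟨$⟩ʳ s))) (cls-X⁻¹ isX)) (sym (P-far d)))

  one : Fin m
  one = suc zero

  inS-one : inS one ≡ far true
  inS-one = P-inj false (trans (P-inS one) (sym P-right-left))

  inB-one : inB one ≡ far false
  inB-one = P-inj true (trans (P-inB one) (sym P-left-right))

  class-inS-one : class true (inS one) ≡ X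
  class-inS-one = trans (cong (class true) inS-one) (class-far true)

  class-inB-one : class false (inB one) ≡ X
  class-inB-one = trans (cong (class false) inB-one) (class-far false)

  π₀ = proj₁ matching

  -- The matching is changed to fix `one`, so that `ψ` exchanges `far true` = `inS one` and
  -- `far false` = `inB one`.
  π : Permutation′ m
  π = transpose one (π₀ ⟨$⟩ˡ one) ∘ₚ π₀

  π-one : π ⟨$⟩ʳ one ≡ one
  π-one = trans (cong (π₀ ⟨$⟩ʳ_) (transpose-left one (π₀ ⟨$⟩ˡ one))) (inverseʳ π₀)

  X≢B : X ≢ B
  X≢B ()

  X≢S : X ≢ S
  X≢S ()

  π-matches : Matches π
  π-matches j = cases (j ≟ᶠ one) (j ≟ᶠ b)
    where
    b = π₀ ⟨$⟩ˡ one
    match₀ = proj₂ matching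
    Match : Fin m → Fin m → Set
    Match j k = (class true (inS j) ≡ B → class false (inB k) ≡ S) × (class false (inB k) ≡ S → class true (inS j) ≡ B)
    cases : Dec (j ≡ one) → Dec (j ≡ b) → Match j (π ⟨$⟩ʳ j)
    cases (yes refl) _ = subst (Match one) (sym π-one)
      ((λ e → ⊥-elim (X≢B (trans (sym class-inS-one) e))) , (λ e → ⊥-elim (X≢S (trans (sym class-inB-one) e))))
    cases (no _) (yes refl) = subst (Match b) (sym (cong (π₀ ⟨$⟩ʳ_) (transpose-right one b)))
      ( (λ e → ⊥-elim (X≢S (trans (sym class-inB-one) (subst (λ k → class false (inB k) ≡ S) (inverseʳ π₀) (proj₁ (match₀ b) e)))))
      , (λ e → ⊥-elim (X≢B (trans (sym class-inS-one) (proj₂ (match₀ one) e)))))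
    cases (no j≢one) (no j≢b) = subst (Match j) (sym (cong (π₀ ⟨$⟩ʳ_) (transpose-other j≢one j≢b))) (match₀ j)

  match : ∀ j → class false (inB (π ⟨$⟩ʳ j)) ≡ swapCls (class true (inS j))
  match = matches⇒swap π π-matches X⇒ ⇒X
    where
    X⇒ : ∀ j → class true (inS j) ≡ X → class false (inB (π ⟨$⟩ʳ j)) ≡ X
    X⇒ j isX = trans (cong (class false ∘ inB) (trans (cong (π ⟨$⟩ʳ_) j≡) π-one)) class-inB-one
      where
      j≡ : j ≡ one
      j≡ = inS-injective (trans (X⇒far true (inS j) isX) (sym inS-one))
    ⇒X : ∀ j → class false (inB (π ⟨$⟩ʳ j)) ≡ X → class true (inS j) ≡ X
    ⇒X j isX = trans (cong (class true ∘ inS) j≡) class-inS-one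
      where
      j≡ : j ≡ one
      j≡ = perm-injective π (trans (inB-injective (trans (X⇒far false _ isX) (sym inB-one))) (sym π-one))

  open Involution π match
    (λ s isX → trans (cong (class false) (X⇒far true s isX)) class-right-left)
    (λ s isX → trans (cong (class true) (X⇒far false s isX)) class-left-right)

  middleRow : ∃[ ρ ] (∀ d (t : Fin 1) → ρ ⟨$⟩ʳ flipIf d zero ≡ far d)
  middleRow = extendTwoSided (λ d _ → flipIf d zero) (λ d _ → far d) (λ {d} {d′} → ends d d′) (λ {d} {d′} → fars d d′)
    where
    far≢ : far false ≢ far true
    far≢ eq = X≢S (trans (sym (class-far false)) (trans (cong (class false) eq) class-right-left))
    ends : ∀ d d′ {t t′ : Fin 1} → flipIf {N} d zero ≡ flipIf d′ zero → (d , t) ≡ (d′ , t′)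
    ends false false {zero} {zero} _ = refl
    ends true true {zero} {zero} _ = refl
    ends false true ()
    ends true false ()
    fars : ∀ d d′ {t t′ : Fin 1} → far d ≡ far d′ → (d , t) ≡ (d′ , t′)
    fars false false {zero} {zero} _ = refl
    fars true true {zero} {zero} _ = refl
    fars false true eq = ⊥-elim (far≢ eq)
    fars true false eq = ⊥-elim (far≢ (sym eq))

  rpa : ∃[ A ] RPA-type1234 {N} A
  rpa = array , array-RPA
    where open Assembly half 2m≤N ≤-refl ψ ψ-involutive ψ-class (proj₁ middleRow)
            (λ d s isX → zero , refl , trans (proj₂ middleRow d zero) (sym (X⇒far d s isX)))

-- Orders 1, 3 and 5 by a decision procedure.

module _ {n : ℕ} (A : Array n) where

  -- The height is taken from a finite type, which makes the covering property decidable.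
  Covers : Array n → Set
  Covers A = ∀ (k s : Fin n) → ∃[ r ] ∃[ c ] (toℕ r < suc (toℕ k) × toℕ c < ⌈ n / suc (toℕ k) ⌉ × A r c ≡ s)

  covers? : ∀ A → Dec (Covers A)
  covers? A = all? λ k → all? λ s → any? λ r → any? λ c → _ <? _ ×-dec _ <? _ ×-dec A r c ≟ᶠ s

  Covers⇒ : ∀ {A} → Covers A → UpperLeftCovers A
  Covers⇒ covers zero {{i≢0}} _ = ⊥-elim (≢-nonZero⁻¹ 0 {{i≢0}} refl)
  Covers⇒ covers (suc k) k<n s with covers (fromℕ< k<n) s
  ... | found rewrite toℕ-fromℕ< k<n = found

  Injective? : Dec (∀ r c c′ → A r c ≡ A r c′ → c ≡ c′)
  Injective? = all? λ r → all? λ c → all? λ c′ → A r c ≟ᶠ A r c′ →-dec c ≟ᶠ c′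

  check? : Dec ((∀ r c c′ → A r c ≡ A r c′ → c ≡ c′) × Covers A × Covers (flipCols A) × Covers (flipRows A)
    × Covers (flipRows (flipCols A)))
  check? = Injective? ×-dec covers? A ×-dec covers? (flipCols A) ×-dec covers? (flipRows A)
    ×-dec covers? (flipRows (flipCols A))

  checked⇒RPA : True check? → RPA-type1234 A
  checked⇒RPA checked with toWitness {a? = check?} checked
  ... | inj , ul , ur , ll , lr = (perms , Covers⇒ ul) , (perms , Covers⇒ ur) , (perms , Covers⇒ ll) , (perms , Covers⇒ lr)
    where
    perms : RowsArePermutations A
    perms r = permutation-bijective (injective⇒permutation (A r) (λ {c} {c′} → inj r c c′))

table : ∀ {n} → Vec (Vec (Fin n) n) n → Array n
table rows r c = lookup (lookup rows r) c

rpa₁ : ∃[ A ] RPA-type1234 {1} A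
rpa₁ = table ((0F ∷ []) ∷ []) , checked⇒RPA _ _

rpa₃ : ∃[ A ] RPA-type1234 {3} A
rpa₃ = table ((0F ∷ 1F ∷ 2F ∷ []) ∷ (2F ∷ 0F ∷ 1F ∷ []) ∷ (1F ∷ 2F ∷ 0F ∷ []) ∷ []) , checked⇒RPA _ _

rpa₅ : ∃[ A ] RPA-type1234 {5} A
rpa₅ = table
  ( (0F ∷ 1F ∷ 2F ∷ 3F ∷ 4F ∷ [])
  ∷ (4F ∷ 2F ∷ 3F ∷ 1F ∷ 0F ∷ [])
  ∷ (3F ∷ 0F ∷ 4F ∷ 1F ∷ 2F ∷ [])
  ∷ (1F ∷ 0F ∷ 2F ∷ 4F ∷ 3F ∷ [])
  ∷ (2F ∷ 4F ∷ 3F ∷ 0F ∷ 1F ∷ [])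
  ∷ []) , checked⇒RPA _ _

-- All orders together.

evenOrOdd : ∀ n → ∃[ m ] (n ≡ m + m ⊎ n ≡ suc (m + m))
evenOrOdd zero = 0 , inj₁ refl
evenOrOdd (suc n) with evenOrOdd n
... | m , inj₁ refl = m , inj₂ refl
... | m , inj₂ refl = suc m , inj₁ (cong suc (sym (+-suc m m)))

theorem2p4 : (n : ℕ) → n ≥ 1 → ∃[ A ] RPA-type1234 {n} A
theorem2p4 n n≥1 with evenOrOdd n
theorem2p4 _ () | zero , inj₁ refl
theorem2p4 _ _ | suc M , inj₁ refl = Even.rpa M
theorem2p4 _ _ | 0 , inj₂ refl = rpa₁
theorem2p4 _ _ | 1 , inj₂ refl = rpa₃
theorem2p4 _ _ | 2 , inj₂ refl = rpa₅
theorem2p4 _ _ | suc (suc (suc w)) , inj₂ refl = Odd.rpa w
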